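{- For all $k,l,n,m\in\mathbb{Z}^+$, $|\mathsf{PTAB}(\mathsf{S4BP}^{k,l}_{n,m})|<\aleph_0$.
   Context: Tense formulas use $\Box$, $\Diamond=\neg\Box\neg$ and a past possibility operator written here $\mathsf{P}$; $\mathsf{S4}_t=\mathsf{K}_t\oplus\{\Box p\to p,\Box p\to\Box\Box p\}$. With $\Delta\phi=\phi\vee\Diamond\phi\vee\mathsf{P}\phi$, $\Delta^{j+1}\phi=\Delta\Delta^j\phi$: $\mathbf{bz}_l=\Delta^{l+1}p\to\Delta^lp$; $\mathbf{bw}^+_n=\bigwedge_{i\leq n}\Diamond p_i\to\bigvee_{i\neq j\leq n}\Diamond(p_i\wedge(p_j\vee\Diamond p_j))$; $\mathbf{bw}^-_m$ the same with $\mathsf{P}$ for $\Diamond$; $\mathbf{bd}_1=\Diamond\Box p_0\to p_0$, $\mathbf{bd}_{j+1}=\Diamond(\Box p_j\wedge\neg\mathbf{bd}_j)\to p_j$. $\mathsf{S4BP}^{k,l}_{n,m}=\mathsf{S4}_t\oplus\{\mathbf{bd}_k,\mathbf{bz}_l,\mathbf{bw}^+_n,\mathbf{bw}^-_m\}$ (depth $\le k$, z-degree $\le l$, forth-width $\le n$, back-width $\le m$). $\mathsf{PTAB}(L)$ is the set of pretabular logics (non-tabular, all consistent proper extensions tabular) extending $L$. -}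

module Defs where

open import Data.Nat using (ℕ; zero; suc; _≟_)
open import Data.Bool using (Bool; true; false; _∧_; _∨_; not)
open import Data.Fin using (Fin)
open import Data.List using (List; []; _∷_; upTo; concatMap; filter; map; allFin; foldr)
open import Data.List.Relation.Unary.Any using (Any)
open import Data.Product using (Σ; _×_; _,_)
open import Data.Empty using (⊥)
open import Relation.Nullary using (¬_)
open import Relation.Nullary.Decidable using (¬?)
open import Relation.Binary.PropositionalEquality using (_≡_)

infixr 5 _⇒_

data Fm : Set where
  var : ℕ → Fm
  ⊥' : Fm
  _⇒_ : Fm → Fm → Fm
  □ : Fm → Fm
  ■ : Fm → Fm

¬' : Fm → Fm
¬' φ = φ ⇒ ⊥'

⊤' : Fm
⊤' = ⊥' ⇒ ⊥'

_∨'_ : Fm → Fm → Fm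
φ ∨' ψ = ¬' φ ⇒ ψ

_∧'_ : Fm → Fm → Fm
φ ∧' ψ = ¬' (φ ⇒ ¬' ψ)

◇ : Fm → Fm
◇ φ = ¬' (□ (¬' φ))

P : Fm → Fm
P φ = ¬' (■ (¬' φ))

⋀ : List Fm → Fm
⋀ [] = ⊤'
⋀ (φ ∷ φs) = φ ∧' ⋀ φs

⋁ : List Fm → Fm
⋁ [] = ⊥'
⋁ (φ ∷ φs) = φ ∨' ⋁ φs

Subst : Set
Subst = ℕ → Fm

_[_] : Fm → Subst → Fm
var x [ σ ] = σ x
⊥' [ σ ] = ⊥'
(φ ⇒ ψ) [ σ ] = (φ [ σ ]) ⇒ (ψ [ σ ])
□ φ [ σ ] = □ (φ [ σ ])
■ φ [ σ ] = ■ (φ [ σ ])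

Δ : Fm → Fm
Δ φ = φ ∨' (◇ φ ∨' P φ)

Δ^ : ℕ → Fm → Fm
Δ^ zero φ = φ
Δ^ (suc j) φ = Δ (Δ^ j φ)

p : ℕ → Fm
p = var

bz : ℕ → Fm
bz l = Δ^ (suc l) (p 0) ⇒ Δ^ l (p 0)

bw : (Fm → Fm) → ℕ → Fm
bw M n =
  ⋀ (map (λ i → M (p i)) idx) ⇒
  ⋁ (concatMap (λ i → map (λ j → M (p i ∧' (p j ∨' M (p j))))
                          (filter (λ j → ¬? (i ≟ j)) idx)) idx)
  where
  idx : List ℕ
  idx = upTo (suc n)

bw⁺ : ℕ → Fm
bw⁺ = bw ◇

bw⁻ : ℕ → Fm
bw⁻ = bw P

-- bd₊ j is bd_{j+1}
bd₊ : ℕ → Fm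
bd₊ zero = ◇ (□ (p 0)) ⇒ p 0
bd₊ (suc j) = ◇ (□ (p (suc j)) ∧' ¬' (bd₊ j)) ⇒ p (suc j)

-- bd k for k ≥ 1 is bd_k; the value at k = 0 is an unused placeholder
bd : ℕ → Fm
bd zero = ⊤'
bd (suc j) = bd₊ j

data Kt⊕ (Γ : Fm → Set) : Fm → Set where
  ax   : ∀ {φ} → Γ φ → Kt⊕ Γ φ
  A1   : ∀ φ ψ → Kt⊕ Γ (φ ⇒ ψ ⇒ φ)
  A2   : ∀ φ ψ χ → Kt⊕ Γ ((φ ⇒ ψ ⇒ χ) ⇒ (φ ⇒ ψ) ⇒ φ ⇒ χ)
  A3   : ∀ φ → Kt⊕ Γ (¬' (¬' φ) ⇒ φ)
  K□   : ∀ φ ψ → Kt⊕ Γ (□ (φ ⇒ ψ) ⇒ □ φ ⇒ □ ψ)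
  K■   : ∀ φ ψ → Kt⊕ Γ (■ (φ ⇒ ψ) ⇒ ■ φ ⇒ ■ ψ)
  conv□ : ∀ φ → Kt⊕ Γ (φ ⇒ □ (P φ))
  conv■ : ∀ φ → Kt⊕ Γ (φ ⇒ ■ (◇ φ))
  mp   : ∀ {φ ψ} → Kt⊕ Γ (φ ⇒ ψ) → Kt⊕ Γ φ → Kt⊕ Γ ψ
  nec□ : ∀ {φ} → Kt⊕ Γ φ → Kt⊕ Γ (□ φ)
  nec■ : ∀ {φ} → Kt⊕ Γ φ → Kt⊕ Γ (■ φ)
  sub  : ∀ {φ} (σ : Subst) → Kt⊕ Γ φ → Kt⊕ Γ (φ [ σ ])

data S4BPAx (k l n m : ℕ) : Fm → Set where
  T    : S4BPAx k l n m (□ (p 0) ⇒ p 0)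
  Four : S4BPAx k l n m (□ (p 0) ⇒ □ (□ (p 0)))
  BD   : S4BPAx k l n m (bd k)
  BZ   : S4BPAx k l n m (bz l)
  BW⁺  : S4BPAx k l n m (bw⁺ n)
  BW⁻  : S4BPAx k l n m (bw⁻ m)

S4BP : ℕ → ℕ → ℕ → ℕ → Fm → Set
S4BP k l n m = Kt⊕ (S4BPAx k l n m)

Logic : Set₁
Logic = Fm → Set

record NormalTenseLogic (L : Logic) : Set where
  field
    A1ᴸ   : ∀ φ ψ → L (φ ⇒ ψ ⇒ φ)
    A2ᴸ   : ∀ φ ψ χ → L ((φ ⇒ ψ ⇒ χ) ⇒ (φ ⇒ ψ) ⇒ φ ⇒ χ)
    A3ᴸ   : ∀ φ → L (¬' (¬' φ) ⇒ φ)
    K□ᴸ   : ∀ φ ψ → L (□ (φ ⇒ ψ) ⇒ □ φ ⇒ □ ψ)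
    K■ᴸ   : ∀ φ ψ → L (■ (φ ⇒ ψ) ⇒ ■ φ ⇒ ■ ψ)
    conv□ᴸ : ∀ φ → L (φ ⇒ □ (P φ))
    conv■ᴸ : ∀ φ → L (φ ⇒ ■ (◇ φ))
    mpᴸ   : ∀ {φ ψ} → L (φ ⇒ ψ) → L φ → L ψ
    nec□ᴸ : ∀ {φ} → L φ → L (□ φ)
    nec■ᴸ : ∀ {φ} → L φ → L (■ φ)
    subᴸ  : ∀ {φ} (σ : Subst) → L φ → L (φ [ σ ])

_⊆_ : Logic → Logic → Set
L ⊆ L' = ∀ φ → L φ → L' φ

_≐_ : Logic → Logic → Set
L ≐ L' = (L ⊆ L') × (L' ⊆ L)

Ext : Logic → Logic → Set
Ext Λ L = NormalTenseLogic L × (Λ ⊆ L)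

Consistent : Logic → Set
Consistent L = ¬ L ⊥'

allB : {A : Set} → (A → Bool) → List A → Bool
allB f = foldr (λ x b → f x ∧ b) true

eval : {w : ℕ} → (Fin w → Fin w → Bool) → (ℕ → Fin w → Bool) → Fm → Fin w → Bool
eval R V (var x) u = V x u
eval R V ⊥' u = false
eval R V (φ ⇒ ψ) u = not (eval R V φ u) ∨ eval R V ψ u
eval {w} R V (□ φ) u = allB (λ v → not (R u v) ∨ eval R V φ v) (allFin w)
eval {w} R V (■ φ) u = allB (λ v → not (R v u) ∨ eval R V φ v) (allFin w)

ValidIn : {w : ℕ} → (Fin w → Fin w → Bool) → Fm → Set
ValidIn {w} R φ = ∀ (V : ℕ → Fin w → Bool) (u : Fin w) → eval R V φ u ≡ true

LogFrame : {w : ℕ} → (Fin w → Fin w → Bool) → Logic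
LogFrame R φ = ValidIn R φ

Tabular : Logic → Set
Tabular L = Σ ℕ λ w → Σ (Fin w → Fin w → Bool) λ R → L ≐ LogFrame R

Pretabular : Logic → Logic → Set₁
Pretabular Λ L =
  Ext Λ L × ¬ Tabular L ×
  (∀ L' → Ext L L' → Consistent L' → (Σ Fm λ φ → L' φ × ¬ L φ) → Tabular L')

FinitelyManyPTAB : Logic → Set₁
FinitelyManyPTAB Λ = Σ (List Logic) λ Ls → ∀ L → Pretabular Λ L → Any (λ L' → L ≐ L') Ls

-- In a canonical model of an extension L of S4BP the clusters of equal height above
-- (or below) a point are pairwise incomparable, so bd, bw⁺ and bw⁻ bound the number
-- of clusters seen in one step, and with bz each component has at most N clusters, N
-- depending on k, l, n, m only. In v variables a cluster has at most 2 ^ v points.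
--
-- Let α K say that a component has at most K points. If L contains some α K, it is the
-- logic of its finitely many frames of size at most K; so a pretabular L refutes all
-- α K. Refuting α (N * c) in finitely many variables gives a finite frame of L having
-- at most N clusters, one of them with more than c points; collapsing the clusters
-- gives a frame of L with at most N points, one of which is blown up to c + 1 copies.
-- One of these finitely many shapes occurs for unboundedly many c. The logic of all
-- its blow-ups is a non-tabular extension of L, hence equals L.
--
-- The case distinctions needed here are available because a pretabular L implies
-- excluded middle: adding to L an axiom that is conditional on a proposition Q gives a
-- tabular, hence decidable, logic. Before that is known, completeness and the bounds on
-- components are proved with negation replaced by implication of a fixed proposition.
module Submission where

open import Defs
open import Level using (Level; 0ℓ; _⊔_) renaming (suc to lsuc)
open import Data.Nat using (ℕ; zero; suc; _≤_; _<_; _+_; _*_; _^_; z≤n; s≤s; _≟_)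
import Data.Nat as ℕ
import Data.Nat.Properties as ℕₚ
open import Data.Bool using (Bool; true; false; _∨_; not)
import Data.Bool as 𝔹
import Data.Bool.Properties as 𝔹ₚ
open import Data.Fin using (Fin; toℕ; fromℕ<; splitAt; _↑ˡ_; _↑ʳ_)
import Data.Fin as F
import Data.Fin.Properties as Fₚ
open import Data.List using (List; []; _∷_; _++_; upTo; concatMap; filter; map; allFin; length; lookup; tabulate)
import Data.List.Properties as Lₚ
open import Data.List.Relation.Unary.Any using (Any; here; there)
import Data.List.Relation.Unary.Any as Any
import Data.List.Relation.Unary.Any.Properties as Anyₚ
open import Data.List.Relation.Unary.All using (All; []; _∷_)
import Data.List.Relation.Unary.All as All
import Data.List.Relation.Unary.All.Properties as Allₚ
open import Data.List.Relation.Unary.AllPairs using (AllPairs; []; _∷_)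
import Data.List.Relation.Unary.AllPairs as AllPairs
import Data.List.Relation.Unary.AllPairs.Properties as AllPairsₚ
open import Data.List.Relation.Binary.Pointwise using (Pointwise; []; _∷_)
open import Data.List.Membership.Propositional using (_∈_; lose; find)
import Data.List.Membership.Propositional.Properties as ∈ₚ
open import Data.Product using (Σ; _×_; _,_; proj₁; proj₂)
open import Data.Sum using (_⊎_; inj₁; inj₂)
open import Data.Empty using (⊥; ⊥-elim)
open import Data.Unit using (⊤; tt)
open import Function using (id; _∘_)
open import Relation.Nullary using (¬_; Dec; yes; no)
open import Relation.Nullary.Decidable using (does; dec-true; ¬?; _⊎-dec_)
open import Relation.Binary.Definitions using (tri<; tri≈; tri>)
open import Relation.Binary.PropositionalEquality using (_≡_; _≢_; refl; sym; trans; cong; cong₂; subst)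

-- Classical reasoning relative to an answer type

DN : Set → ∀ {ℓ} → Set ℓ → Set ℓ
DN A X = (X → A) → A

-- Closure under substitution is left out, so that the formulas `φ` with `L (φ [ τ ])` qualify for
-- any fixed `τ`; this yields canonical models in finitely many variables.
record Theory (Th : Fm → Set) : Set where
  field
    tA1 : ∀ φ ψ → Th (φ ⇒ ψ ⇒ φ)
    tA2 : ∀ φ ψ χ → Th ((φ ⇒ ψ ⇒ χ) ⇒ (φ ⇒ ψ) ⇒ φ ⇒ χ)
    tA3 : ∀ φ → Th (¬' (¬' φ) ⇒ φ)
    tK□ : ∀ φ ψ → Th (□ (φ ⇒ ψ) ⇒ □ φ ⇒ □ ψ)
    tK■ : ∀ φ ψ → Th (■ (φ ⇒ ψ) ⇒ ■ φ ⇒ ■ ψ)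
    tc□ : ∀ φ → Th (φ ⇒ □ (P φ))
    tc■ : ∀ φ → Th (φ ⇒ ■ (◇ φ))
    tmp : ∀ {φ ψ} → Th (φ ⇒ ψ) → Th φ → Th ψ
    tn□ : ∀ {φ} → Th φ → Th (□ φ)
    tn■ : ∀ {φ} → Th φ → Th (■ φ)

theory-[] : ∀ {L} → NormalTenseLogic L → (τ : Subst) → Theory (λ φ → L (φ [ τ ]))
theory-[] N τ = record
  { tA1 = λ φ ψ → A1ᴸ _ _ ; tA2 = λ φ ψ χ → A2ᴸ _ _ _ ; tA3 = λ φ → A3ᴸ _
  ; tK□ = λ φ ψ → K□ᴸ _ _ ; tK■ = λ φ ψ → K■ᴸ _ _
  ; tc□ = λ φ → conv□ᴸ _ ; tc■ = λ φ → conv■ᴸ _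
  ; tmp = mpᴸ ; tn□ = nec□ᴸ ; tn■ = nec■ᴸ }
  where open NormalTenseLogic N

-- Satisfaction is classical only relative to A: falsum holds exactly when A
-- does, and the clauses are stable under double A-negation. Taking A to be the
-- provability of a formula makes completeness constructive.
record Model (ℓ : Level) (A : Set) : Set (lsuc ℓ) where
  infix 4 _⊩_
  field
    W      : Set ℓ
    _⊩_    : W → Fm → Set
    R      : W → W → Set
    stable : ∀ {x φ} → DN A (x ⊩ φ) → x ⊩ φ
    ⊩⊥     : ∀ {x} → x ⊩ ⊥' → A
    ⇒I     : ∀ {x φ ψ} → (x ⊩ φ → x ⊩ ψ) → x ⊩ φ ⇒ ψ
    ⇒E     : ∀ {x φ ψ} → x ⊩ φ ⇒ ψ → x ⊩ φ → x ⊩ ψ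
    □I     : ∀ {x φ} → (∀ y → R x y → y ⊩ φ) → x ⊩ □ φ
    □E     : ∀ {x y φ} → x ⊩ □ φ → R x y → y ⊩ φ
    ■I     : ∀ {x φ} → (∀ y → R y x → y ⊩ φ) → x ⊩ ■ φ
    ■E     : ∀ {x y φ} → x ⊩ ■ φ → R y x → y ⊩ φ

-- Enumeration of all formulas

formulas : ℕ → List Fm
formulas zero = []
formulas (suc n) = formulas n ++ var n ∷ ⊥' ∷
  concatMap (λ φ → □ φ ∷ ■ φ ∷ map (φ ⇒_) (formulas n)) (formulas n)

formulas-mono : ∀ {m n φ} → m ≤ n → φ ∈ formulas m → φ ∈ formulas n
formulas-mono {m} {n} le i = go (ℕₚ.≤⇒≤′ le)
  where
  go : ∀ {n} → m ℕ.≤′ n → _ ∈ formulas n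
  go ℕ.≤′-refl = i
  go (ℕ.≤′-step l) = ∈ₚ.∈-++⁺ˡ (go l)

private
  compound : ∀ {n φ χ} → φ ∈ formulas n →
    χ ∈ (□ φ ∷ ■ φ ∷ map (φ ⇒_) (formulas n)) → χ ∈ formulas (suc n)
  compound {n} i j = ∈ₚ.∈-++⁺ʳ (formulas n) (there (there
    (∈ₚ.∈-concatMap⁺ (λ φ → □ φ ∷ ■ φ ∷ map (φ ⇒_) (formulas n)) (lose i j))))

formulas-complete : ∀ φ → Σ ℕ λ n → φ ∈ formulas n
formulas-complete (var x) = suc x , ∈ₚ.∈-++⁺ʳ (formulas x) (here refl)
formulas-complete ⊥' = 1 , there (here refl)
formulas-complete (φ ⇒ ψ) with formulas-complete φ | formulas-complete ψ
... | m , i | n , j = suc (m ℕ.⊔ n) ,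
  compound {m ℕ.⊔ n} (formulas-mono (ℕₚ.m≤m⊔n m n) i)
    (there (there (∈ₚ.∈-map⁺ _ (formulas-mono (ℕₚ.m≤n⊔m m n) j))))
formulas-complete (□ φ) with formulas-complete φ
... | m , i = suc m , compound {m} i (here refl)
formulas-complete (■ φ) with formulas-complete φ
... | m , i = suc m , compound {m} i (there (here refl))

-- The canonical model

module Canonical {Th : Fm → Set} (th : Theory Th) (A : Set) where
  open Theory th

  data Der (Γ : Fm → Set) : Fm → Set where
    hyp : ∀ {φ} → Γ φ → Der Γ φ
    thm : ∀ {φ} → Th φ → Der Γ φ
    dmp : ∀ {φ ψ} → Der Γ (φ ⇒ ψ) → Der Γ φ → Der Γ ψ

  infixl 5 _,,_
  data _,,_ (Γ : Fm → Set) (φ : Fm) : Fm → Set where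
    old : ∀ {ψ} → Γ ψ → (Γ ,, φ) ψ
    new : (Γ ,, φ) φ

  cut : ∀ {Γ Δ φ} → (∀ {ψ} → Γ ψ → Der Δ ψ) → Der Γ φ → Der Δ φ
  cut f (hyp h) = f h
  cut f (thm t) = thm t
  cut f (dmp d e) = dmp (cut f d) (cut f e)

  ⇒-refl : ∀ φ → Th (φ ⇒ φ)
  ⇒-refl φ = tmp (tmp (tA2 φ (φ ⇒ φ) φ) (tA1 _ _)) (tA1 _ _)

  deduction : ∀ {Γ φ ψ} → Der (Γ ,, φ) ψ → Der Γ (φ ⇒ ψ)
  deduction (hyp (old h)) = dmp (thm (tA1 _ _)) (hyp h)
  deduction (hyp new) = thm (⇒-refl _)
  deduction (thm t) = dmp (thm (tA1 _ _)) (thm t)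
  deduction (dmp d e) = dmp (dmp (thm (tA2 _ _ _)) (deduction d)) (deduction e)

  close : ∀ {φ} → Der (λ _ → ⊥) φ → Th φ
  close (thm t) = t
  close (dmp d e) = tmp (close d) (close e)

  double-neg : ∀ φ → Th (φ ⇒ ¬' (¬' φ))
  double-neg φ = close (deduction (deduction (dmp (hyp new) (hyp (old new)))))

  Con : (Fm → Set) → Set
  Con Γ = Der Γ ⊥' → A

  -- A Lindenbaum step without a case distinction: `φ` enters together with a proof that adding it
  -- is consistent.
  data Ext1 (Γ : Fm → Set) (φ : Fm) : Fm → Set where
    old : ∀ {ψ} → Γ ψ → Ext1 Γ φ ψ
    new : Con (Γ ,, φ) → Ext1 Γ φ φ

  -- A derivation either avoids the new hypothesis, or it carries the proof that adding `φ` is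
  -- consistent, which then applies to it.
  ext1-con : ∀ {Γ φ} → Con Γ → Con (Ext1 Γ φ)
  ext1-con {Γ} {φ} c d with split d
    where
    split : ∀ {ψ} → Der (Ext1 Γ φ) ψ → Der Γ ψ ⊎ (Con (Γ ,, φ) × Der (Γ ,, φ) ψ)
    split (hyp (old h)) = inj₁ (hyp h)
    split (hyp (new k)) = inj₂ (k , hyp new)
    split (thm t) = inj₁ (thm t)
    split (dmp d e) with split d | split e
    ... | inj₁ d' | inj₁ e' = inj₁ (dmp d' e')
    ... | inj₁ d' | inj₂ (k , e') = inj₂ (k , dmp (cut (λ h → hyp (old h)) d') e')
    ... | inj₂ (k , d') | inj₁ e' = inj₂ (k , dmp d' (cut (λ h → hyp (old h)) e'))
    ... | inj₂ (k , d') | inj₂ (_ , e') = inj₂ (k , dmp d' e')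
  ... | inj₁ d' = c d'
  ... | inj₂ (k , d') = k d'

  extend : List Fm → (Fm → Set) → Fm → Set
  extend [] Γ = Γ
  extend (φ ∷ φs) Γ = extend φs (Ext1 Γ φ)

  extend-con : ∀ φs {Γ} → Con Γ → Con (extend φs Γ)
  extend-con [] c = c
  extend-con (φ ∷ φs) c = extend-con φs (ext1-con c)

  extend-⊇ : ∀ φs {Γ ψ} → Γ ψ → extend φs Γ ψ
  extend-⊇ [] h = h
  extend-⊇ (φ ∷ φs) h = extend-⊇ φs (old h)

  module Lindenbaum (Γ : Fm → Set) (c : Con Γ) where
    stage : ℕ → Fm → Set
    stage zero = Γ
    stage (suc n) = extend (formulas n) (stage n)

    stage-con : ∀ n → Con (stage n)
    stage-con zero = c
    stage-con (suc n) = extend-con (formulas n) (stage-con n)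

    stage-mono : ∀ {m n ψ} → m ≤ n → stage m ψ → stage n ψ
    stage-mono {m} {n} {ψ} le h = go (ℕₚ.≤⇒≤′ le)
      where
      go : ∀ {n} → m ℕ.≤′ n → stage n ψ
      go ℕ.≤′-refl = h
      go (ℕ.≤′-step {n} l) = extend-⊇ (formulas n) (go l)

    limit : Fm → Set
    limit φ = Σ ℕ λ n → stage n φ

    compact : ∀ {φ} → Der limit φ → Σ ℕ λ n → Der (stage n) φ
    compact (hyp (n , h)) = n , hyp h
    compact (thm t) = 0 , thm t
    compact (dmp d e) with compact d | compact e
    ... | m , d' | n , e' = m ℕ.⊔ n ,
      dmp (cut (λ h → hyp (stage-mono (ℕₚ.m≤m⊔n m n) h)) d')
          (cut (λ h → hyp (stage-mono (ℕₚ.m≤n⊔m m n) h)) e')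

    limit-con : Con limit
    limit-con d with compact d
    ... | n , d' = stage-con n d'

    -- `Γ'` is the set reached just before `φ` is treated. It lies below the limit, so a formula
    -- consistent with the limit was consistent then and has been added.
    extend-decides : ∀ φs {Γ φ} → φ ∈ φs → Σ (Fm → Set) λ Γ' →
      (∀ {ψ} → Γ' ψ → extend φs Γ ψ) × (Con (Γ' ,, φ) → extend φs Γ φ)
    extend-decides (φ ∷ φs) {Γ} (here refl) =
      Γ , (λ h → extend-⊇ φs (old h)) , λ k → extend-⊇ φs (new k)
    extend-decides (φ ∷ φs) (there i) = extend-decides φs i

    limit-decides : ∀ φ → Con (limit ,, φ) → limit φ
    limit-decides φ k with formulas-complete φ
    ... | n , i with extend-decides (formulas n) {stage n} i
    ...   | Γ' , inc , dec = suc n ,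
      dec (λ d → k (cut (λ { (old h) → hyp (old (suc n , inc h)) ; new → hyp new }) d))

  record Point : Set₁ where
    field
      mem  : Fm → Set
      pthm : ∀ {φ} → Th φ → mem φ
      pmp  : ∀ {φ ψ} → mem (φ ⇒ ψ) → mem φ → mem ψ
      p⊥   : mem ⊥' → A
      pneg : ∀ {φ} → (mem (¬' φ) → A) → mem φ
  open Point

  lindenbaum : ∀ Γ → Con Γ → Σ Point λ x → ∀ {φ} → Γ φ → mem x φ
  lindenbaum Γ c = record
    { mem = Der limit ; pthm = thm ; pmp = dmp ; p⊥ = limit-con
    ; pneg = λ {φ} k → hyp (limit-decides φ (λ d → k (deduction d))) }
    , λ h → hyp (0 , h)
    where open Lindenbaum Γ c

  module _ {x : Point} where
    p-stable : ∀ {φ} → DN A (mem x φ) → mem x φ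
    p-stable k = pneg x λ n → k λ h → p⊥ x (pmp x n h)

    p-neg : ∀ {φ} → (mem x φ → A) → mem x (¬' φ)
    p-neg k = pneg x λ n → k (pmp x (pthm x (tA3 _)) n)

    p-⇒ : ∀ {φ ψ} → (mem x φ → mem x ψ) → mem x (φ ⇒ ψ)
    p-⇒ {φ} {ψ} f = p-stable λ k →
      k (pmp x (exfalso φ ψ) (p-neg λ h → k (pmp x (pthm x (tA1 _ _)) (f h))))
      where
      exfalso : ∀ φ ψ → mem x (¬' φ ⇒ φ ⇒ ψ)
      exfalso φ ψ = pthm x (close (deduction (deduction (dmp (thm (tA3 ψ))
        (dmp (thm (tA1 _ _)) (dmp (hyp (old new)) (hyp new)))))))

  necessitate : (B : Fm → Fm) → (∀ φ ψ → Th (B (φ ⇒ ψ) ⇒ B φ ⇒ B ψ)) →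
    (∀ {φ} → Th φ → Th (B φ)) → (x : Point) →
    ∀ {φ} → Der (λ ψ → mem x (B ψ)) φ → mem x (B φ)
  necessitate B K N x (hyp h) = h
  necessitate B K N x (thm t) = pthm x (N t)
  necessitate B K N x (dmp d e) =
    pmp x (pmp x (pthm x (K _ _)) (necessitate B K N x d)) (necessitate B K N x e)

  canonical : Model (lsuc 0ℓ) A
  canonical = record
    { W = Point ; _⊩_ = mem ; R = λ x y → ∀ φ → mem x (□ φ) → mem y φ
    ; stable = λ {x} → p-stable {x} ; ⊩⊥ = λ {x} → p⊥ x ; ⇒I = λ {x} → p-⇒ {x}
    ; ⇒E = λ {x} → pmp x
    ; □I = λ {x} → box-I □ tK□ tn□ x
    ; □E = λ h r → r _ h
    ; ■I = λ {x} f → box-I ■ tK■ tn■ x λ y r → f y (flip-R x y r)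
    ; ■E = λ {x} {y} h r → unflip-R y x r _ h }
    where
    box-I : (B : Fm → Fm) → (∀ φ ψ → Th (B (φ ⇒ ψ) ⇒ B φ ⇒ B ψ)) →
      (∀ {φ} → Th φ → Th (B φ)) → (x : Point) →
      ∀ {φ} → (∀ y → (∀ ψ → mem x (B ψ) → mem y ψ) → mem y φ) → mem x (B φ)
    box-I B K N x {φ} f = p-stable {x} λ k →
      let con d = k (necessitate B K N x (dmp (thm (tA3 φ)) (deduction d)))
          y , inc = lindenbaum ((λ ψ → mem x (B ψ)) ,, ¬' φ) con
      in p⊥ y (pmp y (inc new) (f y λ ψ h → inc (old h)))

    -- The relation read off from `■` is the converse of the one read off from `□`: were `φ` false
    -- at `x`, then `■ (◇ (¬' φ))` would hold there, so `◇ (¬' φ)` at `y`, against `□ φ`.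
    flip-R : ∀ x y → (∀ ψ → mem x (■ ψ) → mem y ψ) → ∀ φ → mem y (□ φ) → mem x φ
    flip-R x y r φ h = p-stable {x} λ k → p⊥ y (pmp y
      (r _ (pmp x (pthm x (tc■ _)) (p-neg {x} k)))
      (pmp y (pmp y (pthm y (tK□ _ _)) (pthm y (tn□ (double-neg _)))) h))

    unflip-R : ∀ y x → (∀ φ → mem y (□ φ) → mem x φ) → ∀ ψ → mem x (■ ψ) → mem y ψ
    unflip-R y x r ψ h = p-stable {y} λ k → p⊥ x (pmp x
      (r _ (pmp y (pthm y (tc□ _)) (p-neg {y} k)))
      (pmp x (pmp x (pthm x (tK■ _ _)) (pthm x (tn■ (double-neg _)))) h))

  open Model canonical using (_⊩_)

  sound : ∀ {φ} → Th φ → ∀ x → x ⊩ φ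
  sound t x = pthm x t

  -- With `A` the provability of `φ` and `k` the identity this is plain completeness; with `A = ⊥`
  -- it says that an unprovable formula cannot hold everywhere.
  complete : ∀ {φ} → (Th φ → A) → (∀ x → x ⊩ φ) → A
  complete {φ} k f = 
    let con d = k (close (dmp (thm (tA3 φ)) (deduction d)))
        x , inc = lindenbaum ((λ _ → ⊥) ,, ¬' φ) con
    in p⊥ x (pmp x (inc new) (f x))

-- Formula schemes bounding width and size

nth : List Fm → ℕ → Fm
nth [] i = ⊤'
nth (φ ∷ φs) zero = φ
nth (φ ∷ φs) (suc i) = nth φs i

AllPairs-lookup : ∀ {a r} {X : Set a} {Q : X → X → Set r} {xs} → AllPairs Q xs →
  ∀ {i j} → i F.< j → Q (lookup xs i) (lookup xs j)
AllPairs-lookup (q ∷ qs) {F.zero} {F.suc j} lt = All.lookup q (∈ₚ.∈-lookup j)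
AllPairs-lookup (q ∷ qs) {F.suc i} {F.suc j} (s≤s lt) = AllPairs-lookup qs lt

-- The common shape of bw and of the axiom α bounding the size of a component.
width : (Fm → Fm) → (Fm → Fm → Fm) → ℕ → Fm
width M In n =
  ⋀ (map (λ i → M (p i)) (upTo (suc n))) ⇒
  ⋁ (concatMap (λ i → map (λ j → In (p i) (p j))
                          (filter (λ j → ¬? (i ≟ j)) (upTo (suc n)))) (upTo (suc n)))

Δ^-[] : ∀ l φ σ → Δ^ l φ [ σ ] ≡ Δ^ l (φ [ σ ])
Δ^-[] zero φ σ = refl
Δ^-[] (suc l) φ σ = cong Δ (Δ^-[] l φ σ)

-- Among any n + 1 formulas that are each true within `l` steps, two are true together within `l`
-- steps. Under `bz l` these steps exhaust the component, so this allows at most n points up to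
-- equivalence.
α : ℕ → ℕ → Fm
α l = width (Δ^ l) (λ a b → Δ^ l (a ∧' b))

-- Case distinctions and finite choice under relative double negation

module _ {A : Set} where

  dn-em : ∀ {x} {X : Set x} → DN A (X ⊎ (X → A))
  dn-em k = k (inj₂ λ x → k (inj₁ x))

  dn-All : ∀ {a q} {X : Set a} {Q : X → Set q} {xs} →
    All (λ x → DN A (Q x)) xs → DN A (All Q xs)
  dn-All [] k = k []
  dn-All (q ∷ qs) k = q λ h → dn-All qs λ hs → k (h ∷ hs)

  dn-AllPairs : ∀ {a q} {X : Set a} {Q : X → X → Set q} {xs} →
    AllPairs (λ x y → DN A (Q x y)) xs → DN A (AllPairs Q xs)
  dn-AllPairs [] k = k []
  dn-AllPairs (q ∷ qs) k = dn-All q λ h → dn-AllPairs qs λ hs → k (h ∷ hs)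

  dn-Fin : ∀ {q} n {Q : Fin n → Set q} → (∀ i → DN A (Q i)) → DN A (∀ i → Q i)
  dn-Fin zero f k = k λ ()
  dn-Fin (suc n) f k = f F.zero λ h → dn-Fin n (λ i → f (F.suc i)) λ hs →
    k λ { F.zero → h ; (F.suc i) → hs i }

  -- Covers and pairwise inequivalent lists, relative to A

  module _ {w q e} {W : Set w} (Q : W → Set q) (E : W → W → Set e) where

    Apart : W → W → Set e
    Apart x y = E x y → A

    -- Two ways to say that there are at most `N` classes: `Small` is the form that the width axioms
    -- speak about, `Cover` the form that can be added and multiplied. `greedy` and `cover-small`
    -- translate between them.
    Small : ℕ → Set (w ⊔ q ⊔ e)
    Small N = ∀ ys → length ys ≡ suc N → AllPairs Apart ys → All Q ys → A

    Covers : List W → Set (w ⊔ q ⊔ e)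
    Covers ys = ∀ x → Q x → DN A (Any (E x) ys)

    Cover : ℕ → Set (w ⊔ q ⊔ e)
    Cover N = DN A (Σ (List W) λ ys → length ys ≤ N × Covers ys)

    ApartCover : ℕ → Set (w ⊔ q ⊔ e)
    ApartCover N = DN A (Σ (List W) λ ys →
      length ys ≤ N × AllPairs Apart ys × All Q ys × Covers ys)

    -- Points are added as long as some point is apart from all chosen ones. `Small` forbids more
    -- than `N` of them, and a list that cannot be prolonged covers; `fuel` counts the points still
    -- allowed.
    greedy : ∀ {N} → Small N → ApartCover N
    greedy {N} small = go N [] (ℕₚ.+-identityʳ N) [] []
      where
      go : ∀ fuel ys → fuel + length ys ≡ N → AllPairs Apart ys → All Q ys → ApartCover N
      go fuel ys eq ap qs k = dn-em {X = Σ W λ x → Q x × All (Apart x) ys}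
        λ { (inj₂ none) → k (ys , ℕₚ.≤-trans (ℕₚ.m≤n+m _ fuel) (ℕₚ.≤-reflexive eq) , ap , qs ,
              λ x qx j → none (x , qx , ¬Any⇒Apart j))
          ; (inj₁ (x , qx , far)) → more fuel eq x qx far k }
        where
        ¬Any⇒Apart : ∀ {x ys} → (Any (E x) ys → A) → All (Apart x) ys
        ¬Any⇒Apart {ys = []} j = []
        ¬Any⇒Apart {ys = y ∷ ys} j = (λ e → j (here e)) ∷ ¬Any⇒Apart (λ a → j (there a))
        more : ∀ fuel → fuel + length ys ≡ N → ∀ x → Q x → All (Apart x) ys → ApartCover N
        more zero eq x qx far k = small (x ∷ ys) (cong suc eq) (far ∷ ap) (qx ∷ qs)
        more (suc f) eq x qx far k = go f (x ∷ ys) (trans (ℕₚ.+-suc f _) eq) (far ∷ ap) (qx ∷ qs) k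

    -- Pigeonhole: of `N + 1` points two are assigned the same member of the cover, and are then
    -- equivalent by `euclid`.
    cover-small : (∀ {x y z} → E x z → E y z → E x y) → ∀ {N} → Cover N → Small N
    cover-small euclid cover ys eq ap qs = cover λ (cs , le , cov) →
      dn-All (All.map (λ {y} → cov y) qs) λ near →
      let f : Fin (length ys) → Fin (length cs)
          f i = Any.index (All.lookup near (∈ₚ.∈-lookup i))
          i , j , i<j , same = Fₚ.pigeonhole (subst (length cs <_) (sym eq) (s≤s le)) f
      in AllPairs-lookup ap i<j (euclid
           (Anyₚ.lookup-index (All.lookup near (∈ₚ.∈-lookup i)))
           (subst (λ c → E (lookup ys j) (lookup cs c)) (sym same)
             (Anyₚ.lookup-index (All.lookup near (∈ₚ.∈-lookup j)))))

  module _ {w q e} {W : Set w} {Q : W → Set q} {E : W → W → Set e} where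

    cover-≤ : ∀ {M N} → M ≤ N → Cover Q E M → Cover Q E N
    cover-≤ le c k = c λ (ys , l , h) → k (ys , ℕₚ.≤-trans l le , h)

    cover-⊎ : ∀ {q'} {Q' : W → Set q'} {M N} → Cover Q E M → Cover Q' E N →
      Cover (λ x → DN A (Q x ⊎ Q' x)) E (M + N)
    cover-⊎ c d k = c λ (ys , l , h) → d λ (zs , l' , h') → k (ys ++ zs ,
      subst (_≤ _) (sym (Lₚ.length-++ ys)) (ℕₚ.+-mono-≤ l l') ,
      λ x q j → q λ { (inj₁ u) → h x u λ a → j (Anyₚ.++⁺ˡ a)
                    ; (inj₂ v) → h' x v λ a → j (Anyₚ.++⁺ʳ ys a) })

    cover-⊆ : ∀ {q'} {Q' : W → Set q'} {N} → (∀ x → Q' x → Q x) → Cover Q E N → Cover Q' E N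
    cover-⊆ inc c k = c λ (ys , l , h) → k (ys , l , λ x q → h x (inc x q))

  module _ {w q e} {W : Set w} {Q : W → Set q} {E : W → W → Set e} where

    -- The covers over the `M` members of the first cover are concatenated. `E'` may be any
    -- relation; in `near-clusters` it is reachability in the remaining steps.
    cover-bind : ∀ {q' e'} {Q' : W → Set q'} {E' : W → W → Set e'} {M N} →
      Cover Q' E' M → (∀ y → Cover (λ x → Q x × E' x y) E N) →
      (∀ x → Q x → Q' x) → Cover Q E (M * N)
    cover-bind {Q' = Q'} {E'} {M} {N} c f inc k = c λ (ys , l , h) → 
      (go ys λ (zs , l' , h') → k (zs , ℕₚ.≤-trans l' (ℕₚ.*-monoˡ-≤ N l) ,
        λ x q j → h x (inc x q) λ a → h' x (q , a) j))
      where
      go : ∀ ys → Cover (λ x → Q x × Any (E' x) ys) E (length ys * N)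
      go [] k = k ([] , z≤n , λ { x (_ , ()) })
      go (y ∷ ys) = cover-⊆ (λ { x (q , here e) j → j (inj₁ (q , e))
                               ; x (q , there a) j → j (inj₂ (q , a)) })
                            (cover-⊎ (f y) (go ys))

-- Connectives, reachability and separation in a relative model

module Semantics {ℓ} {A : Set} (𝔐 : Model ℓ A) where
  open Model 𝔐 public

  exf : ∀ {x φ} → A → x ⊩ φ
  exf a = stable λ _ → a

  ¬I : ∀ {x φ} → (x ⊩ φ → A) → x ⊩ ¬' φ
  ¬I f = ⇒I λ h → exf (f h)

  ¬E : ∀ {x φ} → x ⊩ ¬' φ → x ⊩ φ → A
  ¬E n h = ⊩⊥ (⇒E n h)

  ⊩⊤ : ∀ {x} → x ⊩ ⊤'
  ⊩⊤ = ⇒I id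

  ∧I : ∀ {x φ ψ} → x ⊩ φ → x ⊩ ψ → x ⊩ φ ∧' ψ
  ∧I a b = ¬I λ h → ¬E (⇒E h a) b

  ∧E₁ : ∀ {x φ ψ} → x ⊩ φ ∧' ψ → x ⊩ φ
  ∧E₁ h = stable λ k → ¬E h (⇒I λ a → exf (k a))

  ∧E₂ : ∀ {x φ ψ} → x ⊩ φ ∧' ψ → x ⊩ ψ
  ∧E₂ h = stable λ k → ¬E h (⇒I λ a → ¬I k)

  ∨I₁ : ∀ {x φ ψ} → x ⊩ φ → x ⊩ φ ∨' ψ
  ∨I₁ a = ⇒I λ n → exf (¬E n a)

  ∨I₂ : ∀ {x φ ψ} → x ⊩ ψ → x ⊩ φ ∨' ψ
  ∨I₂ b = ⇒I λ n → b

  ∨E : ∀ {x φ ψ} → x ⊩ φ ∨' ψ → DN A (x ⊩ φ ⊎ x ⊩ ψ)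
  ∨E h k = k (inj₂ (⇒E h (¬I λ a → k (inj₁ a))))

  ◇I : ∀ {x y φ} → R x y → y ⊩ φ → x ⊩ ◇ φ
  ◇I r h = ¬I λ b → ¬E (□E b r) h

  ◇E : ∀ {x φ} → x ⊩ ◇ φ → DN A (Σ W λ y → R x y × y ⊩ φ)
  ◇E h k = ¬E h (□I λ y r → ¬I λ a → k (y , r , a))

  PI : ∀ {x y φ} → R y x → y ⊩ φ → x ⊩ P φ
  PI r h = ¬I λ b → ¬E (■E b r) h

  PE : ∀ {x φ} → x ⊩ P φ → DN A (Σ W λ y → R y x × y ⊩ φ)
  PE h k = ¬E h (■I λ y r → ¬I λ a → k (y , r , a))

  ⋀I : ∀ {x} σ {φs} → All (λ φ → x ⊩ φ [ σ ]) φs → x ⊩ ⋀ φs [ σ ]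
  ⋀I σ [] = ⊩⊤
  ⋀I σ (h ∷ hs) = ∧I h (⋀I σ hs)

  ⋀E : ∀ {x} σ φs → x ⊩ ⋀ φs [ σ ] → All (λ φ → x ⊩ φ [ σ ]) φs
  ⋀E σ [] h = []
  ⋀E σ (φ ∷ φs) h = ∧E₁ h ∷ ⋀E σ φs (∧E₂ h)

  ⋁I : ∀ {x} σ {φs} → Any (λ φ → x ⊩ φ [ σ ]) φs → x ⊩ ⋁ φs [ σ ]
  ⋁I σ (here h) = ∨I₁ h
  ⋁I σ (there a) = ∨I₂ (⋁I σ a)

  ⋁E : ∀ {x} σ φs → x ⊩ ⋁ φs [ σ ] → DN A (Any (λ φ → x ⊩ φ [ σ ]) φs)
  ⋁E σ [] h k = ⊩⊥ h
  ⋁E σ (φ ∷ φs) h k = ∨E h λ { (inj₁ a) → k (here a)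
                             ; (inj₂ b) → ⋁E σ φs b λ a → k (there a) }

  Step : W → W → Set ℓ
  Step x y = x ≡ y ⊎ (R x y ⊎ R y x)

  -- As a step may stay in place, this is reachability in at most `j` steps, the meaning of `Δ^ j`.
  data Near : ℕ → W → W → Set ℓ where
    nil  : ∀ {x} → Near 0 x x
    cons : ∀ {j x y z} → Step x y → Near j y z → Near (suc j) x z

  near-snoc : ∀ {j x y z} → Near j x y → Step y z → Near (suc j) x z
  near-snoc nil s = cons s nil
  near-snoc (cons s n) t = cons s (near-snoc n t)

  near-refl : ∀ j {x} → Near j x x
  near-refl zero = nil
  near-refl (suc j) = cons (inj₁ refl) (near-refl j)

  Δ^I : ∀ {j x y φ} → Near j x y → y ⊩ φ → x ⊩ Δ^ j φ
  Δ^I nil h = h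
  Δ^I (cons (inj₁ refl) n) h = ∨I₁ (Δ^I n h)
  Δ^I (cons (inj₂ (inj₁ r)) n) h = ∨I₂ (∨I₁ (◇I r (Δ^I n h)))
  Δ^I (cons (inj₂ (inj₂ r)) n) h = ∨I₂ (∨I₂ (PI r (Δ^I n h)))

  Δ^E : ∀ j {x φ} → x ⊩ Δ^ j φ → DN A (Σ W λ y → Near j x y × y ⊩ φ)
  Δ^E zero h k = k (_ , nil , h)
  Δ^E (suc j) h k = ∨E h λ
    { (inj₁ a) → Δ^E j a λ (y , n , b) → k (y , cons (inj₁ refl) n , b)
    ; (inj₂ c) → ∨E c λ
      { (inj₁ a) → ◇E a λ (u , r , d) → Δ^E j d λ (y , n , b) → k (y , cons (inj₂ (inj₁ r)) n , b)
      ; (inj₂ a) → PE a λ (u , r , d) → Δ^E j d λ (y , n , b) → k (y , cons (inj₂ (inj₂ r)) n , b) } }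

  infix 4 _≈_
  -- Equality of theories: one inclusion is enough, since `≈-sym` reverses it through negation.
  _≈_ : W → W → Set
  x ≈ y = ∀ φ → y ⊩ φ → x ⊩ φ

  ≈-refl : ∀ {x} → x ≈ x
  ≈-refl φ h = h

  ≈-sym : ∀ {x y} → x ≈ y → y ≈ x
  ≈-sym e φ h = stable λ k → ¬E (e _ (¬I k)) h

  ≈-euclid : ∀ {x y z} → x ≈ z → y ≈ z → x ≈ y
  ≈-euclid e f φ h = e φ (≈-sym f φ h)

  -- Passes from separating points two at a time to separating them all at once: each point receives
  -- the conjunction of its formulas against the others. `Excl` will be incompatibility at a point
  -- for `α`, and incompatibility along `R` for the width axioms.
  module Separation {e} (Excl : Fm → Fm → Set e)
    (weaken₁ : ∀ {a b} c → Excl a b → Excl (a ∧' c) b)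
    (weaken₂ : ∀ {a b} c → Excl a b → Excl (c ∧' a) b)
    (symm : ∀ {a b} → Excl a b → Excl b a) where

    Sep : W → W → Set e
    Sep x y = Σ Fm λ a → Σ Fm λ b → x ⊩ a × y ⊩ b × Excl a b

    private
      against : ∀ {x} xs → All (Sep x) xs → Σ Fm λ q → Σ (List Fm) λ bs →
        x ⊩ q × Pointwise _⊩_ xs bs × All (Excl q) bs
      against [] [] = ⊤' , [] , ⊩⊤ , [] , []
      against (y ∷ ys) ((a , b , ha , hb , e) ∷ ss) with against ys ss
      ... | q , bs , hq , hbs , es = a ∧' q , b ∷ bs , ∧I ha hq , hb ∷ hbs ,
        weaken₁ q e ∷ All.map (weaken₂ a) es

      meet : List Fm → List Fm → List Fm
      meet (φ ∷ φs) (ψ ∷ ψs) = φ ∧' ψ ∷ meet φs ψs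
      meet _ _ = []

      meet-⊩ : ∀ {xs φs ψs} → Pointwise _⊩_ xs φs → Pointwise _⊩_ xs ψs →
        Pointwise _⊩_ xs (meet φs ψs)
      meet-⊩ [] [] = []
      meet-⊩ (h ∷ hs) (g ∷ gs) = ∧I h g ∷ meet-⊩ hs gs

      meet-All₁ : ∀ {q} φs ψs → All (Excl q) φs → All (Excl q) (meet φs ψs)
      meet-All₁ _ _ [] = []
      meet-All₁ (φ ∷ φs) [] (h ∷ hs) = []
      meet-All₁ (φ ∷ φs) (ψ ∷ ψs) (h ∷ hs) = symm (weaken₁ ψ (symm h)) ∷ meet-All₁ φs ψs hs

      meet-All₂ : ∀ {q} φs ψs → All (Excl q) ψs → All (Excl q) (meet φs ψs)
      meet-All₂ [] _ _ = []
      meet-All₂ (φ ∷ φs) [] [] = []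
      meet-All₂ (φ ∷ φs) (ψ ∷ ψs) (h ∷ hs) = symm (weaken₂ φ (symm h)) ∷ meet-All₂ φs ψs hs

      meet-AllPairs : ∀ φs ψs → AllPairs Excl φs → AllPairs Excl (meet φs ψs)
      meet-AllPairs [] ψs [] = []
      meet-AllPairs (φ ∷ φs) [] (h ∷ hs) = []
      meet-AllPairs (φ ∷ φs) (ψ ∷ ψs) (h ∷ hs) =
        All.map (weaken₁ ψ) (meet-All₁ φs ψs h) ∷ meet-AllPairs φs ψs hs

    separate : ∀ xs → AllPairs Sep xs → Σ (List Fm) λ ps →
      Pointwise _⊩_ xs ps × AllPairs Excl ps
    separate [] [] = [] , [] , []
    separate (x ∷ xs) (s ∷ ss) with separate xs ss | against xs s
    ... | ps , hs , ap | q , bs , hq , hbs , es =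
      q ∷ meet ps bs , hq ∷ meet-⊩ hs hbs , meet-All₂ ps bs es ∷ meet-AllPairs ps bs ap

    nth-⊩ : ∀ {xs ps} → Pointwise _⊩_ xs ps → (i : Fin (length xs)) → lookup xs i ⊩ nth ps (toℕ i)
    nth-⊩ (h ∷ hs) F.zero = h
    nth-⊩ (h ∷ hs) (F.suc i) = nth-⊩ hs i

    nth-Excl : ∀ {xs ps} → Pointwise _⊩_ xs ps → AllPairs Excl ps →
      ∀ {i j} → i < length xs → j < length xs → i ≢ j → Excl (nth ps i) (nth ps j)
    nth-Excl (h ∷ hs) (a ∷ as) {zero} {zero} _ _ ne = ⊥-elim (ne refl)
    nth-Excl (h ∷ hs) (a ∷ as) {zero} {suc j} _ (s≤s l) ne = go hs a l
      where
      go : ∀ {q xs ps} → Pointwise _⊩_ xs ps → All (Excl q) ps →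
        ∀ {j} → j < length xs → Excl q (nth ps j)
      go (h ∷ hs) (a ∷ as) {zero} _ = a
      go (h ∷ hs) (a ∷ as) {suc j} (s≤s l) = go hs as l
    nth-Excl (h ∷ hs) (a ∷ as) {suc i} {zero} (s≤s l) l' ne =
      symm (nth-Excl (h ∷ hs) (a ∷ as) {zero} {suc i} l' (s≤s l) (ne ∘ sym))
    nth-Excl (h ∷ hs) (a ∷ as) {suc i} {suc j} (s≤s l) (s≤s l') ne =
      nth-Excl hs as l l' (ne ∘ cong suc)

    -- For `n + 1` pairwise inequivalent points, substitute their separating formulas for the
    -- variables: the points witness every conjunct of the premise, while exclusion refutes every
    -- disjunct of the conclusion.
    width-small : ∀ {M In} → (∀ φ σ → M φ [ σ ] ≡ M (φ [ σ ])) →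
      (∀ a b σ → In a b [ σ ] ≡ In (a [ σ ]) (b [ σ ])) →
      ∀ {q e'} (Q : W → Set q) (E : W → W → Set e') n r → 
      (∀ σ → r ⊩ width M In n [ σ ]) →
      (∀ x φ → Q x → x ⊩ φ → r ⊩ M φ) →
      (∀ a b → Excl a b → r ⊩ In a b → A) →
      (∀ x y → Q x → Q y → (E x y → A) → DN A (Sep x y)) →
      Small {A} Q E n
    width-small {M} {In} hM hIn Q E n r val hQ hEx hSep xs eq ap qs =
      dn-AllPairs (sep xs ap qs) λ sp →
      let ps , hs , ex = separate xs sp
          σ = nth ps
          bound : ∀ {i} → i ∈ upTo (suc n) → i < length xs
          bound i∈ = subst (_ <_) (sym eq) (∈ₚ.∈-upTo⁻ i∈)
          premise : r ⊩ ⋀ (map (λ i → M (p i)) (upTo (suc n))) [ σ ]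
          premise = ⋀I σ (Allₚ.map⁺ (All.tabulate λ {i} i∈ →
            subst (r ⊩_) (sym (hM (p i) σ))
              (hQ _ (nth ps i) (All.lookup qs (∈ₚ.∈-lookup (fromℕ< (bound i∈))))
                (subst (λ j → lookup xs (fromℕ< (bound i∈)) ⊩ nth ps j)
                  (Fₚ.toℕ-fromℕ< (bound i∈)) (nth-⊩ hs (fromℕ< (bound i∈)))))))
      in ⋁E σ _ (⇒E (val σ) premise) λ any →
      let φ , φ∈ , h = find any
          i , i∈ , φ∈' = find (∈ₚ.∈-concatMap⁻ (inner n) {xs = upTo (suc n)} φ∈)
          j , j∈ , φ≡ = ∈ₚ.∈-map⁻ (λ j → In (p i) (p j)) φ∈'
          j∈' , i≢j = ∈ₚ.∈-filter⁻ (λ j → ¬? (i ≟ j)) {xs = upTo (suc n)} j∈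
      in hEx _ _ (nth-Excl hs ex (bound i∈) (bound j∈') i≢j)
           (subst (r ⊩_) (trans (cong (_[ σ ]) φ≡) (hIn (p i) (p j) σ)) h)
      where
      inner : ℕ → ℕ → List Fm
      inner n i = map (λ j → In (p i) (p j)) (filter (λ j → ¬? (i ≟ j)) (upTo (suc n)))
      sep : ∀ xs → AllPairs (Apart {A} Q E) xs → All Q xs → AllPairs (λ x y → DN A (Sep x y)) xs
      sep [] [] [] = []
      sep (x ∷ xs) (a ∷ as) (q ∷ qs) = go xs a qs ∷ sep xs as qs
        where
        go : ∀ ys → All (Apart {A} Q E x) ys → All Q ys → All (λ y → DN A (Sep x y)) ys
        go [] [] [] = []
        go (y ∷ ys) (a ∷ as) (qy ∷ qs) = hSep x y q qy a ∷ go ys as qs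

  Incompatible : Fm → Fm → Set ℓ
  Incompatible a b = ∀ x → x ⊩ a → x ⊩ b → A

  module ≈-Separation = Separation Incompatible (λ c e x h → e x (∧E₁ h))
    (λ c e x h → e x (∧E₂ h)) (λ e x h g → e x g h)

  ≈-sep : ∀ x y → (x ≈ y → A) → DN A (≈-Separation.Sep x y)
  ≈-sep x y ne k = dn-em {X = Σ Fm λ φ → y ⊩ φ × (x ⊩ φ → A)} λ
    { (inj₁ (φ , hy , hx)) → k (¬' φ , φ , ¬I hx , hy , λ u n h → ¬E n h)
    ; (inj₂ none) → ne λ φ hy → stable λ hx → none (φ , hy , hx) }

  α-small : ∀ {l N r} → (∀ σ → r ⊩ α l N [ σ ]) → Small {A} (Near l r) _≈_ N
  α-small {l} {N} {r} val = ≈-Separation.width-small (λ φ σ → Δ^-[] l φ σ)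
    (λ a b σ → Δ^-[] l (a ∧' b) σ) (Near l r) _≈_ N r val
    (λ x φ n h → Δ^I n h)
    (λ a b e h → Δ^E l h λ (y , _ , hab) → e y (∧E₁ hab) (∧E₂ hab))
    (λ x y _ _ → ≈-sep x y)

  -- Choose a witness for each conjunct of the premise. Two equivalent witnesses would satisfy both
  -- formulas at one point, giving a disjunct; so if the conclusion failed, all `N + 1` would be
  -- apart.
  small-α : ∀ {l N r} → Small {A} (Near l r) _≈_ N → ∀ σ → r ⊩ α l N [ σ ]
  small-α {l} {N} {r} small σ = ⇒I λ pre → stable λ k →
    let hs = Allₚ.map⁻ (⋀E σ (map (λ i → Δ^ l (p i)) (upTo (suc N))) pre)
    in dn-Fin (suc N) {Q = λ i → Σ W λ y → Near l r y × y ⊩ σ (toℕ i)}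
         (λ i → Δ^E l (subst (r ⊩_) (Δ^-[] l (p (toℕ i)) σ)
           (All.lookup hs (∈ₚ.∈-upTo⁺ (Fₚ.toℕ<n i))))) λ f →
       small (tabulate (λ i → proj₁ (f i))) (Lₚ.length-tabulate (λ i → proj₁ (f i)))
         (AllPairsₚ.tabulate⁺-< λ {i} {j} i<j e → k (⋁I σ (lose
           (∈ₚ.∈-concatMap⁺ inner (lose (∈ₚ.∈-upTo⁺ (Fₚ.toℕ<n i))
             (∈ₚ.∈-map⁺ (λ j → Δ^ l (p (toℕ i) ∧' p j))
               (∈ₚ.∈-filter⁺ (λ j → ¬? (toℕ i ≟ j)) (∈ₚ.∈-upTo⁺ (Fₚ.toℕ<n j)) (ℕₚ.<⇒≢ i<j)))))
           (subst (r ⊩_) (sym (Δ^-[] l (p (toℕ i) ∧' p (toℕ j)) σ))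
             (Δ^I (proj₁ (proj₂ (f i))) (∧I (proj₂ (proj₂ (f i))) (e _ (proj₂ (proj₂ (f j))))))))))
         (Allₚ.tabulate⁺ {f = λ i → proj₁ (f i)} λ i → proj₁ (proj₂ (f i)))
    where
    inner : ℕ → List Fm
    inner i = map (λ j → Δ^ l (p i ∧' p j)) (filter (λ j → ¬? (i ≟ j)) (upTo (suc N)))

-- Counting clusters and points of a component

bd-cong : ∀ j {σ τ} → (∀ i → i ≤ j → σ i ≡ τ i) → bd₊ j [ σ ] ≡ bd₊ j [ τ ]
bd-cong zero h rewrite h 0 z≤n = refl
bd-cong (suc j) h rewrite h (suc j) ℕₚ.≤-refl | bd-cong j (λ i le → h i (ℕₚ.m≤n⇒m≤1+n le)) = refl

module _ {ℓ} {A : Set} (𝔐 : Model ℓ A) where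
  open Semantics 𝔐

  -- `tight` holds by definition in a canonical model and lets the axioms act as frame conditions.
  -- Depth `suc k` avoids the placeholder value of `bd`.
  module Bounds
    (tight : ∀ {x y} → (∀ φ → x ⊩ □ φ → y ⊩ φ) → R x y)
    (k l n m : ℕ) (val : ∀ {φ} → S4BPAx (suc k) l n m φ → ∀ σ x → x ⊩ φ [ σ ]) where

    R-refl : ∀ {x} → R x x
    R-refl {x} = tight λ φ h → ⇒E (val T (λ _ → φ) x) h

    R-trans : ∀ {x y z} → R x y → R y z → R x z
    R-trans {x} r s = tight λ φ h → □E (□E (⇒E (val Four (λ _ → φ) x) h) r) s

    ¬R-witness : ∀ {x y} → (R x y → A) → DN A (Σ Fm λ φ → x ⊩ □ φ × y ⊩ ¬' φ)
    ¬R-witness nr k = nr (tight λ φ h → stable λ j → k (φ , h , ¬I j))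

    infix 4 _~_
    _~_ : W → W → Set
    x ~ y = R x y × R y x

    ~-refl : ∀ {x} → x ~ x
    ~-refl = R-refl , R-refl

    ~-trans : ∀ {x y z} → x ~ y → y ~ z → x ~ z
    ~-trans (a , b) (c , d) = R-trans a c , R-trans d b

    ~-sym : ∀ {x y} → x ~ y → y ~ x
    ~-sym (a , b) = b , a

    data Chain : ℕ → W → Set ℓ where
      single : ∀ {x} → Chain 0 x
      climb  : ∀ {j x y} → R x y → (R y x → A) → Chain j y → Chain (suc j) x

    -- An ascent without return gives a `φ` with `□ φ` at the upper and `¬' φ` at the lower point.
    -- It is substituted for the top variable, which does not occur in the `bd₊` of the remaining
    -- chain, so the earlier choices survive.
    chain-refutes-bd : ∀ {j x} → Chain (suc j) x → DN A (Σ Subst λ σ → x ⊩ ¬' (bd₊ j [ σ ]))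
    chain-refutes-bd (climb r nr single) k = ¬R-witness nr λ (φ , h , h') →
      k ((λ _ → φ) , ¬I λ b → ¬E h' (⇒E b (◇I r h)))
    chain-refutes-bd {suc j} {x} (climb {y = y} r nr c@(climb _ _ _)) k =
      chain-refutes-bd c λ (σ , g) → ¬R-witness nr λ (φ , h , h') →
      let τ : Subst
          τ i = pick φ (σ i) (i ≟ suc j)
          top : τ (suc j) ≡ φ
          top = pick-yes φ (σ (suc j)) (suc j ≟ suc j) refl
          low : bd₊ j [ τ ] ≡ bd₊ j [ σ ]
          low = bd-cong j λ i le → pick-no φ (σ i) (i ≟ suc j) (ℕₚ.<⇒≢ (s≤s le))
      in k (τ , ¬I λ b → ¬E (subst (λ ψ → x ⊩ ¬' ψ) (sym top) h')
           (⇒E b (◇I r (∧I (subst (λ ψ → y ⊩ □ ψ) (sym top) h)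
                           (subst (λ ψ → y ⊩ ¬' ψ) (sym low) g)))))
      where
      pick : ∀ {P : Set} → Fm → Fm → Dec P → Fm
      pick φ ψ (yes _) = φ
      pick φ ψ (no _) = ψ
      pick-yes : ∀ {P : Set} φ ψ (d : Dec P) → P → pick φ ψ d ≡ φ
      pick-yes φ ψ (yes _) q = refl
      pick-yes φ ψ (no n) q = ⊥-elim (n q)
      pick-no : ∀ {P : Set} φ ψ (d : Dec P) → ¬ P → pick φ ψ d ≡ ψ
      pick-no φ ψ (yes q) n = ⊥-elim (n q)
      pick-no φ ψ (no _) n = refl

    chain-short : ∀ {x} → Chain (suc k) x → A
    chain-short {x} c = chain-refutes-bd c λ (σ , h) → ¬E h (val BD σ x)

    -- Incompatibility at related points in both orders: with reflexivity this refutes every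
    -- disjunct of `bw⁺` as well as of `bw⁻`.
    Excl : Fm → Fm → Set ℓ
    Excl a b = ∀ x y → R x y → (x ⊩ a → y ⊩ b → A) × (x ⊩ b → y ⊩ a → A)

    module R-Separation = Separation Excl
      (λ c e x y r → (λ h g → proj₁ (e x y r) (∧E₁ h) g) , (λ h g → proj₂ (e x y r) h (∧E₁ g)))
      (λ c e x y r → (λ h g → proj₁ (e x y r) (∧E₂ h) g) , (λ h g → proj₂ (e x y r) h (∧E₂ g)))
      (λ e x y r → proj₂ (e x y r) , proj₁ (e x y r))

    -- For incomparable points take `□ φ` true at `x` with `φ` false at `y`, and `□ ψ` the other way
    -- round. Each box forces its formula at all successors, where the opposite conjunction denies
    -- it.
    R-sep : ∀ {x y} → (R x y → A) → (R y x → A) → DN A (R-Separation.Sep x y)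
    R-sep nr ns k = ¬R-witness nr λ (φ , h , h') → ¬R-witness ns λ (ψ , g , g') →
      k (□ φ ∧' ¬' ψ , □ ψ ∧' ¬' φ , ∧I h g' , ∧I g h' , λ x y r →
        (λ a b → ¬E (∧E₂ b) (□E (∧E₁ a) r)) , (λ b a → ¬E (∧E₂ a) (□E (∧E₁ b) r)))

    -- Distinct clusters of equal height are incomparable.
    Layer : (W → Set) → ℕ → W → Set ℓ
    Layer Q j x = Q x × Chain j x × (Chain (suc j) x → A)

    layer-sep : ∀ {Q j} x y → Layer Q j x → Layer Q j y → (x ~ y → A) → DN A (R-Separation.Sep x y)
    layer-sep x y (_ , c , nc) (_ , d , nd) ne =
      R-sep (λ r → nc (climb r (λ s → ne (r , s)) d)) (λ s → nd (climb s (λ r → ne (r , s)) c))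

    -- Points are sorted by the length of the longest chain starting at them. Lengths run from 0 to
    -- `k`, giving `suc k` layers of at most `w` clusters each.
    clusters : ∀ {Q w} → (∀ j → Small {A} (Layer Q j) _~_ w) → Cover {A} Q _~_ (suc k * w)
    clusters {Q} {w} small = cover-⊆ (λ x q → q , chain-short) (go (suc k))
      where
      go : ∀ j → Cover {A} (λ x → Q x × (Chain j x → A)) _~_ (j * w)
      go zero k = k ([] , z≤n , λ x (_ , c) _ → c single)
      go (suc j) = cover-⊆
        (λ x (q , c) k → dn-em {X = Chain j x} λ
          { (inj₁ d) → k (inj₁ (q , d , c)) ; (inj₂ d) → k (inj₂ (q , d)) })
        (cover-⊎ (λ k → greedy _ _ (small j) λ (ys , le , _ , _ , h) → k (ys , le , h)) (go j))

    above : ∀ r → Cover {A} (λ x → R r x) _~_ (suc k * n)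
    above r = clusters λ j → R-Separation.width-small (λ _ _ → refl) (λ _ _ _ → refl)
      (Layer (R r) j) _~_ n r (λ σ → val BW⁺ σ r) (λ x φ q h → ◇I (proj₁ q) h)
      (λ a b e h → ◇E h λ (y , _ , ab) → ∨E (∧E₂ ab) λ
        { (inj₁ b) → proj₁ (e y y R-refl) (∧E₁ ab) b
        ; (inj₂ b) → ◇E b λ (z , s , c) → proj₁ (e y z s) (∧E₁ ab) c })
      (layer-sep {R r} {j})

    below : ∀ r → Cover {A} (λ x → R x r) _~_ (suc k * m)
    below r = clusters λ j → R-Separation.width-small (λ _ _ → refl) (λ _ _ _ → refl)
      (Layer (λ x → R x r) j) _~_ m r (λ σ → val BW⁻ σ r) (λ x φ q h → PI (proj₁ q) h)
      (λ a b e h → PE h λ (y , _ , ab) → ∨E (∧E₂ ab) λ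
        { (inj₁ b) → proj₁ (e y y R-refl) (∧E₁ ab) b
        ; (inj₂ b) → PE b λ (z , s , c) → proj₂ (e z y s) c (∧E₁ ab) })
      (layer-sep {λ x → R x r} {j})

    -- A cover fixes the intermediate points of a walk only up to `~`, so the walk may first move
    -- inside its initial cluster.
    NearCluster : ℕ → W → W → Set ℓ
    NearCluster j y z = Σ W λ y' → y' ~ y × Near j y' z

    breadth : ℕ
    breadth = suc k * n + suc k * m

    near-clusters : ∀ j y → Cover {A} (NearCluster j y) _~_ (breadth ^ j)
    near-clusters zero y k = k (y ∷ [] , ℕₚ.≤-refl , λ { z (_ , e , nil) j → j (here e) })
    near-clusters (suc j) y = cover-bind {Q' = NearCluster (suc j) y} {E' = λ x u → NearCluster j u x}
      (λ k → cover-⊎ (above y) (below y) λ (us , le , h) → k (us , le ,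
        λ { x (y' , e , cons {y = u} s near) j → h u (λ j → j (side e s)) λ a →
            j (Any.map (λ e' → u , e' , near) a) }))
      (λ u → cover-⊆ (λ x (_ , q) → q) (near-clusters j u))
      (λ x q → q)
      where
      -- Staying in place counts as a step upwards, by membership in the same cluster.
      side : ∀ {y' u} → y' ~ y → Step y' u → R y u ⊎ R u y
      side (a , b) (inj₁ refl) = inj₁ b
      side (a , b) (inj₂ (inj₁ r)) = inj₁ (R-trans b r)
      side (a , b) (inj₂ (inj₂ r)) = inj₂ (R-trans r a)

    component-clusters : ∀ r → Cover {A} (Near l r) _~_ (breadth ^ l)
    component-clusters r = cover-⊆ (λ x h → r , ~-refl , h) (near-clusters l r)

    -- By transitivity the points of a cluster have the same successors and predecessors, so boxed
    -- formulas agree and only the variables can differ.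
    ~-agree : ∀ {x y} → x ~ y → (∀ i → (x ⊩ var i → y ⊩ var i) × (y ⊩ var i → x ⊩ var i)) →
      ∀ φ → (x ⊩ φ → y ⊩ φ) × (y ⊩ φ → x ⊩ φ)
    ~-agree e v (var i) = v i
    ~-agree e v ⊥' = (λ h → exf (⊩⊥ h)) , (λ h → exf (⊩⊥ h))
    ~-agree e v (φ ⇒ ψ) with ~-agree e v φ | ~-agree e v ψ
    ... | f , f' | g , g' = (λ h → ⇒I λ a → g (⇒E h (f' a))) , (λ h → ⇒I λ a → g' (⇒E h (f a)))
    ~-agree (a , b) v (□ φ) = (λ h → □I λ z r → □E h (R-trans a r)) , (λ h → □I λ z r → □E h (R-trans b r))
    ~-agree (a , b) v (■ φ) = (λ h → ■I λ z r → ■E h (R-trans r b)) , (λ h → ■I λ z r → ■E h (R-trans r a))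

    -- The variables from `v` on already agree on `C`. Splitting `C` by the truth of the next lower
    -- variable doubles the bound; when none is left, `~-agree` identifies all points.
    valuations : ∀ v {q} (C : W → Set q) → (∀ x y → C x → C y → x ~ y) →
      (∀ x y i → C x → C y → v ≤ i → x ⊩ var i → y ⊩ var i) → Cover {A} C _≈_ (2 ^ v)
    valuations zero C cl ag k = dn-em {X = Σ W C} λ
      { (inj₁ (y , c)) → k (y ∷ [] , ℕₚ.≤-refl , λ x d j →
          j (here λ φ → proj₂ (~-agree (cl x y d c) (λ i → ag x y i d c z≤n , ag y x i c d z≤n) φ)))
      ; (inj₂ none) → k ([] , z≤n , λ x c _ → none (x , c)) }
    valuations (suc v) C cl ag k = cover-≤ (ℕₚ.≤-reflexive (cong (2 ^ v +_) (sym (ℕₚ.+-identityʳ _))))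
      (cover-⊆ (λ x c j → dn-em {X = x ⊩ var v} λ
          { (inj₁ h) → j (inj₁ (c , h)) ; (inj₂ h) → j (inj₂ (c , h)) })
        (cover-⊎
          (valuations v (λ x → C x × x ⊩ var v) (λ x y c d → cl x y (proj₁ c) (proj₁ d))
            (λ x y i c d le h → case-≤ x y i c d (λ _ → proj₂ d) h (ℕₚ.m≤n⇒m<n∨m≡n le)))
          (valuations v (λ x → C x × (x ⊩ var v → A)) (λ x y c d → cl x y (proj₁ c) (proj₁ d))
            (λ x y i c d le h → case-≤ x y i c d (λ g → exf (proj₂ c g)) h (ℕₚ.m≤n⇒m<n∨m≡n le))))) k
      where
      case-≤ : ∀ {D : W → Set} x y i → C x × D x → C y × D y → (x ⊩ var v → y ⊩ var v) →
        x ⊩ var i → v < i ⊎ v ≡ i → y ⊩ var i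
      case-≤ x y i c d f h (inj₁ lt) = ag x y i (proj₁ c) (proj₁ d) lt h
      case-≤ x y i c d f h (inj₂ refl) = f h

    component-points : ∀ v → (∀ i x → v ≤ i → x ⊩ var i → A) →
      ∀ r → Cover {A} (Near l r) _≈_ (breadth ^ l * 2 ^ v)
    component-points v none r = cover-bind (component-clusters r)
      (λ y → valuations v _ (λ x z (_ , e) (_ , f) → ~-trans e (~-sym f))
        (λ x z i _ _ le h → exf (none i x le h)))
      (λ x q → q)

-- Finite frames

Rel : ℕ → Set
Rel w = Fin w → Fin w → Bool

true≢false : ∀ {b} → b ≡ true → b ≡ false → ⊥
true≢false refl ()

bool-cases : ∀ b → b ≡ true ⊎ b ≡ false
bool-cases true = inj₁ refl
bool-cases false = inj₂ refl

bool-stable : ∀ {b} → ¬ ¬ (b ≡ true) → b ≡ true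
bool-stable {true} k = refl
bool-stable {false} k = ⊥-elim (k λ ())

imp-intro : ∀ {a b} → (a ≡ true → b ≡ true) → not a ∨ b ≡ true
imp-intro {true} f = f refl
imp-intro {false} f = refl

imp-elim : ∀ {a b} → not a ∨ b ≡ true → a ≡ true → b ≡ true
imp-elim {true} h refl = h

imp-false : ∀ {a b} → not a ∨ b ≡ false → a ≡ true × b ≡ false
imp-false {true} h = refl , h

module _ {X : Set} (f : X → Bool) where

  allB-intro : ∀ xs → (∀ x → f x ≡ true) → allB f xs ≡ true
  allB-intro [] h = refl
  allB-intro (x ∷ xs) h rewrite h x = allB-intro xs h

  allB-elim : ∀ {x} xs → allB f xs ≡ true → x ∈ xs → f x ≡ true
  allB-elim (y ∷ ys) h i with f y in eq
  allB-elim (y ∷ ys) h (here refl) | true = eq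
  allB-elim (y ∷ ys) h (there i) | true = allB-elim ys h i

  allB-false : ∀ xs → allB f xs ≡ false → Σ X λ x → f x ≡ false
  allB-false (y ∷ ys) h with f y in eq
  ... | true = allB-false ys h
  ... | false = y , eq

finModel : ∀ {w} → Rel w → (ℕ → Fin w → Bool) → Model 0ℓ ⊥
finModel {w} R V = record
  { W = Fin w ; _⊩_ = λ x φ → eval R V φ x ≡ true ; R = λ x y → R x y ≡ true
  ; stable = bool-stable ; ⊩⊥ = λ () ; ⇒I = imp-intro ; ⇒E = imp-elim
  ; □I = λ f → allB-intro _ (allFin w) λ y → imp-intro (f y)
  ; □E = λ {_} {y} h → imp-elim (allB-elim _ (allFin w) h (∈ₚ.∈-allFin y))
  ; ■I = λ f → allB-intro _ (allFin w) λ y → imp-intro (f y)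
  ; ■E = λ {_} {y} h → imp-elim (allB-elim _ (allFin w) h (∈ₚ.∈-allFin y)) }

-- The zigzag conditions hold only up to `DN A`, and a variable of the frame is matched with the
-- formula `σ v`, so `χ` in the frame corresponds to its instance `χ [ σ ]` in the model. `holds`
-- and `fails` are proved together because implication exchanges them.
record Bisimulation {ℓ} {A : Set} (𝔐 : Model ℓ A) {w} (G : Rel w) {z}
  (Z : Model.W 𝔐 → Fin w → Set z) (V : ℕ → Fin w → Bool) (σ : Subst) : Set (ℓ ⊔ z) where
  open Semantics 𝔐
  field
    forth  : ∀ {x y i} → Z x i → R x y → DN A (Σ (Fin w) λ j → G i j ≡ true × Z y j)
    forth⁻ : ∀ {x y i} → Z x i → R y x → DN A (Σ (Fin w) λ j → G j i ≡ true × Z y j)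
    back   : ∀ {x i j} → Z x i → G i j ≡ true → DN A (Σ W λ y → R x y × Z y j)
    back⁻  : ∀ {x i j} → Z x i → G j i ≡ true → DN A (Σ W λ y → R y x × Z y j)
    pos    : ∀ v {x i} → Z x i → V v i ≡ true → x ⊩ σ v
    neg    : ∀ v {x i} → Z x i → V v i ≡ false → x ⊩ σ v → A

  holds : ∀ φ {x i} → Z x i → eval G V φ i ≡ true → x ⊩ φ [ σ ]
  fails : ∀ φ {x i} → Z x i → eval G V φ i ≡ false → x ⊩ φ [ σ ] → A

  holds (var v) z h = pos v z h
  holds (φ ⇒ ψ) {x} {i} z h with bool-cases (eval G V φ i)
  ... | inj₁ a = ⇒I λ _ → holds ψ z (imp-elim h a)
  ... | inj₂ a = ⇒I λ b → exf (fails φ z a b)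
  holds (□ φ) z h = □I λ y r → stable λ k → forth z r λ (j , g , z') →
    k (holds φ z' (imp-elim (allB-elim _ (allFin w) h (∈ₚ.∈-allFin j)) g))
  holds (■ φ) z h = ■I λ y r → stable λ k → forth⁻ z r λ (j , g , z') →
    k (holds φ z' (imp-elim (allB-elim _ (allFin w) h (∈ₚ.∈-allFin j)) g))

  fails (var v) z h = neg v z h
  fails ⊥' z h = ⊩⊥
  fails (φ ⇒ ψ) z h b with imp-false h
  ... | a , c = fails ψ z c (⇒E b (holds φ z a))
  fails (□ φ) z h b with allB-false _ (allFin w) h
  ... | j , h' with imp-false h'
  ...   | g , c = back z g λ (y , r , z') → fails φ z' c (□E b r)
  fails (■ φ) z h b with allB-false _ (allFin w) h
  ... | j , h' with imp-false h'
  ...   | g , c = back⁻ z g λ (y , r , z') → fails φ z' c (■E b r)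

[var] : ∀ φ → φ [ var ] ≡ φ
[var] (var x) = refl
[var] ⊥' = refl
[var] (φ ⇒ ψ) = cong₂ _⇒_ ([var] φ) ([var] ψ)
[var] (□ φ) = cong □ ([var] φ)
[var] (■ φ) = cong ■ ([var] φ)

-- Bounded morphisms for the tense language: the back condition is required along both directions of
-- the relation.
record Bounded {w w'} (F : Rel w) (G : Rel w') (f : Fin w → Fin w') : Set where
  field
    forth : ∀ {a b} → F a b ≡ true → G (f a) (f b) ≡ true
    back  : ∀ {a c} → G (f a) c ≡ true → Σ (Fin w) λ b → F a b ≡ true × f b ≡ c
    back⁻ : ∀ {a c} → G c (f a) ≡ true → Σ (Fin w) λ b → F b a ≡ true × f b ≡ c

module _ {w w'} {F : Rel w} {G : Rel w'} {f : Fin w → Fin w'} (bd : Bounded F G f) where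
  open Bounded bd

  bounded-eval : ∀ {U V} → (∀ x a → U x a ≡ V x (f a)) → ∀ χ a → eval F U χ a ≡ eval G V χ (f a)
  bounded-eval {U} {V} agree χ a with bool-cases (eval G V χ (f a))
    | Bisimulation.holds bis χ {a} refl | Bisimulation.fails bis χ {a} refl
    where
    bis : Bisimulation (finModel F U) G (λ x i → f x ≡ i) V var
    bis = record
      { forth = λ { refl r k → k (_ , forth r , refl) }
      ; forth⁻ = λ { refl r k → k (_ , forth r , refl) }
      ; back = λ { refl g k → k (back g) } ; back⁻ = λ { refl g k → k (back⁻ g) }
      ; pos = λ { v refl h → trans (agree v _) h }
      ; neg = λ { v refl h h' → true≢false (trans (sym (agree v _)) h') h } }
  ... | inj₁ h | holds | _ =
    trans (subst (λ ψ → eval F U ψ a ≡ true) ([var] χ) (holds h)) (sym h)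
  ... | inj₂ h | _ | fails = trans (𝔹ₚ.¬-not λ h' →
    fails h (subst (λ ψ → eval F U ψ a ≡ true) (sym ([var] χ)) h')) (sym h)

  bounded-onto : (∀ b → Σ (Fin w) λ a → f a ≡ b) → LogFrame F ⊆ LogFrame G
  bounded-onto onto χ h V b with onto b
  ... | a , refl = trans (sym (bounded-eval {λ x a → V x (f a)} {V} (λ _ _ → refl) χ a)) (h _ a)

pointwise-bounded : ∀ {w} {F G : Rel w} → (∀ i j → F i j ≡ G i j) → Bounded F G id
pointwise-bounded e = record
  { forth = λ {a} {b} h → trans (sym (e a b)) h ; back = λ {a} {c} h → c , trans (e a c) h , refl
  ; back⁻ = λ {a} {c} h → c , trans (e c a) h , refl }

pointwise-Log : ∀ {w} {F G : Rel w} → (∀ i j → F i j ≡ G i j) → LogFrame F ⊆ LogFrame G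
pointwise-Log e = bounded-onto (pointwise-bounded e) λ b → b , refl

vars< : Fm → ℕ
vars< (var x) = suc x
vars< ⊥' = 0
vars< (φ ⇒ ψ) = vars< φ ℕ.⊔ vars< ψ
vars< (□ φ) = vars< φ
vars< (■ φ) = vars< φ

τ : ℕ → Subst
τ v x with x ℕ.<? v
... | yes _ = var x
... | no _ = ⊥'

τ-low : ∀ {v x} → x < v → τ v x ≡ var x
τ-low {v} {x} lt with x ℕ.<? v
... | yes _ = refl
... | no n = ⊥-elim (n lt)

τ-high : ∀ {v x} → v ≤ x → τ v x ≡ ⊥'
τ-high {v} {x} le with x ℕ.<? v
... | yes lt = ⊥-elim (ℕₚ.<⇒≱ lt le)
... | no n = refl

[τ] : ∀ v φ → vars< φ ≤ v → φ [ τ v ] ≡ φ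
[τ] v (var x) le = τ-low le
[τ] v ⊥' le = refl
[τ] v (φ ⇒ ψ) le = cong₂ _⇒_ ([τ] v φ (ℕₚ.≤-trans (ℕₚ.m≤m⊔n _ _) le))
  ([τ] v ψ (ℕₚ.≤-trans (ℕₚ.m≤n⊔m _ _) le))
[τ] v (□ φ) le = cong □ ([τ] v φ le)
[τ] v (■ φ) le = cong ■ ([τ] v φ le)

-- The finite frame of a component

module _ {ℓ} {A : Set} (𝔐 : Model ℓ A) where
  open Semantics 𝔐

  -- The component of `r` modulo equality of theories, given by a list of representatives. `dec`
  -- makes the relation between them Boolean, and is supplied under double negation.
  module Component
    (tight : ∀ {x y} → (∀ φ → x ⊩ □ φ → y ⊩ φ) → R x y)
    (l : ℕ) (bz-valid : ∀ σ x → x ⊩ bz l [ σ ]) (r : W) (ys : List W)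
    (apart : AllPairs (Apart {A} (Near l r) _≈_) ys) (near : All (Near l r) ys)
    (covers : Covers {A} (Near l r) _≈_ ys)
    (dec : ∀ i j → R (lookup ys i) (lookup ys j) ⊎ (R (lookup ys i) (lookup ys j) → A)) where

    w : ℕ
    w = length ys

    pt : Fin w → W
    pt = lookup ys

    pt-near : ∀ i → Near l r (pt i)
    pt-near i = All.lookup near (∈ₚ.∈-lookup i)

    avoid : ∀ {y} zs → All (λ z → DN A (Σ Fm λ φ → y ⊩ φ × (z ⊩ φ → A))) zs →
      DN A (Σ Fm λ θ → y ⊩ θ × All (λ z → z ⊩ θ → A) zs)
    avoid [] [] k = k (⊤' , ⊩⊤ , [])
    avoid (z ∷ zs) (h ∷ hs) k = h λ (φ , a , b) → avoid zs hs λ (θ , c , d) →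
      k (φ ∧' θ , ∧I a c , (λ g → b (∧E₁ g)) ∷ All.map (λ f g → f (∧E₂ g)) d)

    -- The component closes off here: a point within `l + 1` steps that differs from all
    -- representatives satisfies some `θ` false at each of them. By `bz` such a `θ` is true within
    -- `l` steps already, at a point that the representatives cover.
    covers-suc : ∀ y → Near (suc l) r y → DN A (Any (y ≈_) ys)
    covers-suc y ny k = avoid ys (All.tabulate λ {z} z∈ j → k (lose z∈ λ φ hz →
        stable (λ nh → j (¬' φ , ¬I nh , λ hn → ¬E hn hz)))) λ (θ , hy , hz) →
      Δ^E l (subst (r ⊩_) (Δ^-[] l (p 0) (λ _ → θ))
        (⇒E (bz-valid (λ _ → θ) r) (subst (r ⊩_) (sym (Δ^-[] (suc l) (p 0) (λ _ → θ))) (Δ^I ny hy)))) λ (x , nx , hx) →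
      covers x nx λ a →
        All.lookup hz (proj₁ (proj₂ (find a))) (≈-sym (proj₂ (proj₂ (find a))) θ hx)

    index : ∀ i {y} → Step (pt i) y → DN A (Σ (Fin w) λ j → y ≈ pt j)
    index i s k = covers-suc _ (near-snoc (pt-near i) s) λ a → k (Any.index a , Anyₚ.lookup-index a)

    F : Rel w
    F i j = [ dec i j ]ᵇ
      where
      [_]ᵇ : ∀ {x y} {X : Set x} {Y : Set y} → X ⊎ Y → Bool
      [ inj₁ _ ]ᵇ = true
      [ inj₂ _ ]ᵇ = false

    F-sound : ∀ {i j} → F i j ≡ true → R (pt i) (pt j)
    F-sound {i} {j} h with dec i j
    ... | inj₁ r = r

    F-complete : ∀ {i j} → R (pt i) (pt j) → DN A (F i j ≡ true)
    F-complete {i} {j} r k with dec i j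
    ... | inj₁ _ = k refl
    ... | inj₂ n = n r

    R-≈ : ∀ {x x' y y'} → x ≈ x' → y ≈ y' → R x y → R x' y'
    R-≈ e f r = tight λ φ h → ≈-sym f φ (□E (e _ h) r)

    bisimulation : ∀ {V σ} →
      (∀ v i → V v i ≡ true → pt i ⊩ σ v) → (∀ v i → V v i ≡ false → pt i ⊩ σ v → A) →
      Bisimulation 𝔐 F (λ x i → x ≈ pt i) V σ
    bisimulation pos neg = record
      { forth = λ {x} {y} {i} e r k → index i (inj₂ (inj₁ (R-≈ e ≈-refl r))) λ (j , f) →
          F-complete (R-≈ e f r) λ h → k (j , h , f)
      ; forth⁻ = λ {x} {y} {i} e r k → index i (inj₂ (inj₂ (R-≈ ≈-refl e r))) λ (j , f) →
          F-complete (R-≈ f e r) λ h → k (j , h , f)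
      ; back = λ {x} {i} {j} e h k → k (pt j , R-≈ (≈-sym e) ≈-refl (F-sound h) , ≈-refl)
      ; back⁻ = λ {x} {i} {j} e h k → k (pt j , R-≈ ≈-refl (≈-sym e) (F-sound h) , ≈-refl)
      ; pos = λ v {x} {i} e t → e _ (pos v i t)
      ; neg = λ v {x} {i} e t g → neg v i t (≈-sym e _ g) }

    -- Pairwise inequivalent points, being finitely many, have mutually exclusive formulas; a set of
    -- them is defined by the disjunction over its members.
    definable : DN A ((S : Fin w → Bool) → Σ Fm λ θ →
      (∀ i → S i ≡ true → pt i ⊩ θ) × (∀ i → S i ≡ false → pt i ⊩ θ → A))
    definable k = dn-AllPairs (AllPairs.map (λ {x} {y} → ≈-sep x y) apart) λ sp →
      let ps , hs , ex = ≈-Separation.separate ys sp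
          δ : Fin w → Fm
          δ i = nth ps (toℕ i)
          on : (S : Fin w → Bool) → List (Fin w)
          on S = filter (λ i → S i 𝔹.≟ true) (allFin w)
      in k λ S → ⋁ (map δ (on S)) [ var ] ,
        (λ i h → ⋁I var (Anyₚ.map⁺ (lose (∈ₚ.∈-filter⁺ (λ i → S i 𝔹.≟ true) (∈ₚ.∈-allFin i) h)
          (subst (pt i ⊩_) (sym ([var] (δ i))) (≈-Separation.nth-⊩ hs i))))) ,
        λ i h g → ⋁E var _ g λ a →
          let j , j∈ , g' = find (Anyₚ.map⁻ a)
              _ , Sj = ∈ₚ.∈-filter⁻ (λ i → S i 𝔹.≟ true) {xs = allFin w} j∈
          in ≈-Separation.nth-Excl hs ex (Fₚ.toℕ<n i) (Fₚ.toℕ<n j)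
               (λ e → true≢false (trans (cong S (Fₚ.toℕ-injective e)) Sj) h)
               (pt i) (≈-Separation.nth-⊩ hs i) (subst (pt i ⊩_) ([var] (δ j)) g')

    -- Every valuation on the frame is definable, so a failure of `χ` there is a failure of a
    -- substitution instance of `χ` in the model.
    refuted : ∀ χ → (∀ σ x → x ⊩ χ [ σ ]) → ∀ V i → eval F V χ i ≡ false → A
    refuted χ valid V i h = definable λ def →
      let bis = bisimulation {V} {λ v → proj₁ (def (V v))}
            (λ v → proj₁ (proj₂ (def (V v)))) (λ v → proj₂ (proj₂ (def (V v))))
      in Bisimulation.fails bis χ (≈-refl {pt i}) h (valid _ (pt i))

    -- The valuation is read off from the model at the representatives. Only the variables below
    -- `vars< φ` are decided, which is a finite task; the others are false, in accordance with
    -- `τ v`.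
    satisfied : ∀ φ → (∀ V i → eval F V φ i ≡ true) → r ⊩ φ
    satisfied φ valid = stable λ k →
      covers r (near-refl l) λ a →
      dn-Fin w (λ i → dn-Fin v {λ x → pt i ⊩ var (toℕ x) ⊎ (pt i ⊩ var (toℕ x) → A)} (λ x → dn-em)) λ d →
      let V : ℕ → Fin w → Bool
          V x i = val i x (d i)
          bis = bisimulation {V} {τ v} (λ x i → pos i x (d i)) (λ x i → neg i x (d i))
      in k (subst (r ⊩_) ([τ] v φ ℕₚ.≤-refl)
           (Bisimulation.holds bis φ (Anyₚ.lookup-index a) (valid V (Any.index a))))
      where
      v : ℕ
      v = vars< φ
      D : Fin w → Set
      D i = (x : Fin v) → pt i ⊩ var (toℕ x) ⊎ (pt i ⊩ var (toℕ x) → A)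
      left : ∀ {X Y : Set} → X ⊎ Y → Bool
      left (inj₁ _) = true
      left (inj₂ _) = false
      val : (i : Fin w) → ℕ → D i → Bool
      val i x d with x ℕ.<? v
      ... | yes lt = left (d (fromℕ< lt))
      ... | no _ = false
      pos : ∀ i x d → val i x d ≡ true → pt i ⊩ τ v x
      pos i x d t with x ℕ.<? v
      ... | yes lt with d (fromℕ< lt)
      ...   | inj₁ h = subst (λ y → pt i ⊩ var y) (Fₚ.toℕ-fromℕ< lt) h
      neg : ∀ i x d → val i x d ≡ false → pt i ⊩ τ v x → A
      neg i x d t g with x ℕ.<? v
      ... | no _ = ⊩⊥ g
      ... | yes lt with d (fromℕ< lt)
      ...   | inj₂ n = n (subst (λ y → pt i ⊩ var y) (sym (Fₚ.toℕ-fromℕ< lt)) g)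

-- Enumeration and disjoint unions of finite frames

functions : ∀ {X : Set} n → List X → List (Fin n → X)
functions zero xs = (λ ()) ∷ []
functions {X} (suc n) xs = concatMap (λ x → map (extend x) (functions n xs)) xs
  where
  extend : X → (Fin n → X) → Fin (suc n) → X
  extend x f F.zero = x
  extend x f (F.suc i) = f i

-- Membership is up to a pointwise relation `S`, so that no extensionality is used; for relations
-- `S` is itself pointwise equality of rows.
functions-complete : ∀ {X : Set} (S : X → X → Set) n xs (f : Fin n → X) →
  (∀ i → Σ X λ y → y ∈ xs × S (f i) y) →
  Σ (Fin n → X) λ g → g ∈ functions n xs × (∀ i → S (f i) (g i))
functions-complete S zero xs f h = _ , here refl , λ ()
functions-complete S (suc n) xs f h
  with h F.zero | functions-complete S n xs (λ i → f (F.suc i)) (λ i → h (F.suc i))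
... | y , y∈ , s | g , g∈ , t = _ , ∈ₚ.∈-concatMap⁺ _ (lose y∈ (∈ₚ.∈-map⁺ _ g∈)) ,
  λ { F.zero → s ; (F.suc i) → t i }

relations : ∀ w → List (Rel w)
relations w = functions w (functions w (true ∷ false ∷ []))

relations-complete : ∀ {w} (F : Rel w) → Σ (Rel w) λ G → G ∈ relations w × (∀ i j → F i j ≡ G i j)
relations-complete {w} F = functions-complete (λ f g → ∀ j → f j ≡ g j) w _ F λ i →
  functions-complete _≡_ w _ (F i) λ j → F i j , bool∈ (F i j) , refl
  where
  bool∈ : ∀ b → b ∈ true ∷ false ∷ []
  bool∈ true = here refl
  bool∈ false = there (here refl)

Frame : Set
Frame = Σ ℕ Rel

Log : Frame → Logic
Log (w , F) = LogFrame F

frames : ℕ → List Frame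
frames K = concatMap (λ w → map (w ,_) (relations w)) (upTo (suc K))

frames-complete : ∀ {K w} → w ≤ K → (F : Rel w) →
  Σ (Rel w) λ G → (w , G) ∈ frames K × (∀ i j → F i j ≡ G i j)
frames-complete le F with relations-complete F
... | G , G∈ , e = G , 
  ∈ₚ.∈-concatMap⁺ (λ w → map {B = Frame} (w ,_) (relations w))
    (lose (∈ₚ.∈-upTo⁺ (s≤s le)) (∈ₚ.∈-map⁺ (_ ,_) G∈)) , e

module _ {w w'} (F : Rel w) (G : Rel w') where
  private
    rel : Fin w ⊎ Fin w' → Fin w ⊎ Fin w' → Bool
    rel (inj₁ i) (inj₁ j) = F i j
    rel (inj₂ i) (inj₂ j) = G i j
    rel _ _ = false

  _⊎ᶠ_ : Rel (w + w')
  _⊎ᶠ_ a b = rel (splitAt w a) (splitAt w b)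

  private
    left-bounded : Bounded F _⊎ᶠ_ (_↑ˡ w')
    left-bounded = record
      { forth = λ {a} {b} h → trans (cong₂ rel (Fₚ.splitAt-↑ˡ w a w') (Fₚ.splitAt-↑ˡ w b w')) h
      ; back = λ {a} {c} h → go a c _ refl (subst (λ s → rel s (splitAt w c) ≡ true) (Fₚ.splitAt-↑ˡ w a w') h)
      ; back⁻ = λ {a} {c} h → go⁻ a c _ refl (subst (λ s → rel (splitAt w c) s ≡ true) (Fₚ.splitAt-↑ˡ w a w') h) }
      where
      go : ∀ a c s → splitAt w c ≡ s → rel (inj₁ a) (splitAt w c) ≡ true →
        Σ (Fin w) λ b → F a b ≡ true × b ↑ˡ w' ≡ c
      go a c (inj₁ b) eq h = b , subst (λ s → rel (inj₁ a) s ≡ true) eq h , Fₚ.splitAt⁻¹-↑ˡ eq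
      go a c (inj₂ b) eq h with () ← subst (λ s → rel (inj₁ a) s ≡ true) eq h
      go⁻ : ∀ a c s → splitAt w c ≡ s → rel (splitAt w c) (inj₁ a) ≡ true →
        Σ (Fin w) λ b → F b a ≡ true × b ↑ˡ w' ≡ c
      go⁻ a c (inj₁ b) eq h = b , subst (λ s → rel s (inj₁ a) ≡ true) eq h , Fₚ.splitAt⁻¹-↑ˡ eq
      go⁻ a c (inj₂ b) eq h with () ← subst (λ s → rel s (inj₁ a) ≡ true) eq h

    right-bounded : Bounded G _⊎ᶠ_ (w ↑ʳ_)
    right-bounded = record
      { forth = λ {a} {b} h → trans (cong₂ rel (Fₚ.splitAt-↑ʳ w w' a) (Fₚ.splitAt-↑ʳ w w' b)) h
      ; back = λ {a} {c} h → go a c _ refl (subst (λ s → rel s (splitAt w c) ≡ true) (Fₚ.splitAt-↑ʳ w w' a) h)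
      ; back⁻ = λ {a} {c} h → go⁻ a c _ refl (subst (λ s → rel (splitAt w c) s ≡ true) (Fₚ.splitAt-↑ʳ w w' a) h) }
      where
      go : ∀ a c s → splitAt w c ≡ s → rel (inj₂ a) (splitAt w c) ≡ true →
        Σ (Fin w') λ b → G a b ≡ true × w ↑ʳ b ≡ c
      go a c (inj₂ b) eq h = b , subst (λ s → rel (inj₂ a) s ≡ true) eq h , Fₚ.splitAt⁻¹-↑ʳ eq
      go a c (inj₁ b) eq h with () ← subst (λ s → rel (inj₂ a) s ≡ true) eq h
      go⁻ : ∀ a c s → splitAt w c ≡ s → rel (splitAt w c) (inj₂ a) ≡ true →
        Σ (Fin w') λ b → G b a ≡ true × w ↑ʳ b ≡ c
      go⁻ a c (inj₂ b) eq h = b , subst (λ s → rel s (inj₂ a) ≡ true) eq h , Fₚ.splitAt⁻¹-↑ʳ eq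
      go⁻ a c (inj₁ b) eq h with () ← subst (λ s → rel s (inj₂ a) ≡ true) eq h

  ⊎ᶠ-valid : ∀ χ → LogFrame F χ → LogFrame G χ → LogFrame _⊎ᶠ_ χ
  ⊎ᶠ-valid χ f g V u with splitAt w u in eq
  ... | inj₁ a = subst (λ u → eval _⊎ᶠ_ V χ u ≡ true) (Fₚ.splitAt⁻¹-↑ˡ eq)
    (trans (sym (bounded-eval left-bounded {λ x a → V x (a ↑ˡ w')} {V} (λ _ _ → refl) χ a)) (f _ a))
  ... | inj₂ a = subst (λ u → eval _⊎ᶠ_ V χ u ≡ true) (Fₚ.splitAt⁻¹-↑ʳ eq)
    (trans (sym (bounded-eval right-bounded {λ x a → V x (w ↑ʳ a)} {V} (λ _ _ → refl) χ a)) (g _ a))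

  ⊎ᶠ-left : LogFrame _⊎ᶠ_ ⊆ LogFrame F
  ⊎ᶠ-left χ h V a = trans (bounded-eval left-bounded {V} {λ x u → by (V x) (splitAt w u)}
      (λ x a → sym (cong (by (V x)) (Fₚ.splitAt-↑ˡ w a w'))) χ a) (h _ (a ↑ˡ w'))
    where
    by : (Fin w → Bool) → Fin w ⊎ Fin w' → Bool
    by v (inj₁ a) = v a
    by v (inj₂ _) = false

  ⊎ᶠ-right : LogFrame _⊎ᶠ_ ⊆ LogFrame G
  ⊎ᶠ-right χ h V a = trans (bounded-eval right-bounded {V} {λ x u → by (V x) (splitAt w u)}
      (λ x a → sym (cong (by (V x)) (Fₚ.splitAt-↑ʳ w w' a))) χ a) (h _ (w ↑ʳ a))
    where
    by : (Fin w' → Bool) → Fin w ⊎ Fin w' → Bool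
    by v (inj₁ _) = false
    by v (inj₂ a) = v a

-- `Tabular` asks for a single frame. The disjoint union replaces finitely many frames by one whose
-- logic is the intersection of theirs.
⋃ᶠ : List Frame → Frame
⋃ᶠ [] = 0 , λ ()
⋃ᶠ ((w , F) ∷ fs) = w + proj₁ (⋃ᶠ fs) , F ⊎ᶠ proj₂ (⋃ᶠ fs)

⋃ᶠ-valid : ∀ χ fs → All (λ f → Log f χ) fs → Log (⋃ᶠ fs) χ
⋃ᶠ-valid χ [] [] V ()
⋃ᶠ-valid χ ((w , F) ∷ fs) (h ∷ hs) = ⊎ᶠ-valid F (proj₂ (⋃ᶠ fs)) χ h (⋃ᶠ-valid χ fs hs)

⋃ᶠ-member : ∀ χ {f} fs → f ∈ fs → Log (⋃ᶠ fs) χ → Log f χ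
⋃ᶠ-member χ ((w , F) ∷ fs) (here refl) h = ⊎ᶠ-left F (proj₂ (⋃ᶠ fs)) χ h
⋃ᶠ-member χ ((w , F) ∷ fs) (there i) h = ⋃ᶠ-member χ fs i (⊎ᶠ-right F (proj₂ (⋃ᶠ fs)) χ h)

-- Extensions of S4BP

module Extension (k l n m : ℕ) {L : Logic} (N : NormalTenseLogic L)
  (ext : S4BP (suc k) l n m ⊆ L) where
  open NormalTenseLogic N

  -- `ρ = var` gives the canonical model of `L`, and `ρ = τ v` the one in `v` variables.
  module At (ρ : Subst) (A : Set) where
    open Canonical (theory-[] N ρ) A public using (canonical; sound; complete)
    open Semantics canonical public

    valid : ∀ {φ} → L φ → ∀ σ x → x ⊩ φ [ σ ]
    valid h σ x = sound (subᴸ ρ (subᴸ σ h)) x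

    axioms-valid : ∀ {φ} → S4BPAx (suc k) l n m φ → ∀ σ x → x ⊩ φ [ σ ]
    axioms-valid {φ} h = valid (ext φ (ax h))

    module B = Bounds canonical id k l n m axioms-valid

    module C = Component canonical id l (axioms-valid BZ)

    decide-R : ∀ ys → DN A (∀ i j → R (lookup ys i) (lookup ys j) ⊎ (R (lookup ys i) (lookup ys j) → A))
    decide-R ys = dn-Fin _ {λ i → ∀ j → R (lookup ys i) (lookup ys j) ⊎ (R (lookup ys i) (lookup ys j) → A)}
      λ i → dn-Fin _ {λ j → R (lookup ys i) (lookup ys j) ⊎ (R (lookup ys i) (lookup ys j) → A)} λ j → dn-em

  Bad : Frame → Set
  Bad (w , F) = Σ Fm λ χ → L χ × Σ (ℕ → Fin w → Bool) λ V → Σ (Fin w) λ i → eval F V χ i ≡ false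

  not-bad : ∀ f → ¬ Bad f → L ⊆ Log f
  not-bad (w , F) nb χ h V i with bool-cases (eval F V χ i)
  ... | inj₁ t = t
  ... | inj₂ f = ⊥-elim (nb (χ , h , V , i , f))

  good : ∀ {fs} → All (λ f → Bad f ⊎ ¬ Bad f) fs → List Frame
  good [] = []
  good (inj₁ _ ∷ ds) = good ds
  good {f ∷ _} (inj₂ _ ∷ ds) = f ∷ good ds

  good-sound : ∀ {fs} (ds : All (λ f → Bad f ⊎ ¬ Bad f) fs) → All (λ f → ¬ Bad f) (good ds)
  good-sound [] = []
  good-sound (inj₁ _ ∷ ds) = good-sound ds
  good-sound (inj₂ g ∷ ds) = g ∷ good-sound ds

  good-complete : ∀ {f fs} (ds : All (λ f → Bad f ⊎ ¬ Bad f) fs) → f ∈ fs → Bad f ⊎ f ∈ good ds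
  good-complete (inj₁ b ∷ ds) (here refl) = inj₁ b
  good-complete (inj₁ _ ∷ ds) (there i) = good-complete ds i
  good-complete (inj₂ _ ∷ ds) (here refl) = inj₂ (here refl)
  good-complete (inj₂ _ ∷ ds) (there i) with good-complete ds i
  ... | inj₁ b = inj₁ b
  ... | inj₂ j = inj₂ (there j)

  -- L is the logic of the frames of size at most K that do not refute it; only
  -- finitely many undecided alternatives are needed to find them.
  bounded-tabular : ∀ K → L (α l K) → ¬ ¬ Tabular L
  bounded-tabular K hα = λ k → dn-All {A = ⊥} {Q = λ f → Bad f ⊎ ¬ Bad f} {xs = frames K}
    (All.tabulate λ _ → dn-em) λ ds → k
      ( proj₁ (⋃ᶠ (good ds)) , proj₂ (⋃ᶠ (good ds))
      , (λ χ h → ⋃ᶠ-valid χ (good ds) (All.map (λ {f} nb → not-bad f nb χ h) (good-sound ds)))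
      , λ φ h → back ds φ h )
    where
    back : (ds : All (λ f → Bad f ⊎ ¬ Bad f) (frames K)) → Log (⋃ᶠ (good ds)) ⊆ L
    -- The finite frame of the component of `x` agrees with a listed one. If that is bad, `refuted`
    -- gives the answer; otherwise `φ` is valid in it and hence true at `x`.
    back ds φ h = subst L ([var] φ) (complete {φ} id λ x → stable {x} {φ} λ j →
        greedy (Near l x) _≈_ (α-small {l} {K} {x} (λ σ → valid hα σ x)) λ (ys , le , ap , nr , cov) →
        decide-R ys λ dec →
        let open C x ys ap nr cov dec
            G , G∈ , e = frames-complete le F
        in by-case x ys ap nr cov dec G e (good-complete ds G∈) j)
      where
      open At var (L (φ [ var ]))
      by-case : ∀ x ys ap nr cov dec → let open C x ys ap nr cov dec in
        (G : Rel w) → (∀ i j → F i j ≡ G i j) → Bad (w , G) ⊎ (w , G) ∈ good ds →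
        (x ⊩ φ → L (φ [ var ])) → L (φ [ var ])
      by-case x ys ap nr cov dec G e (inj₁ (χ , hχ , V , i , f)) j = refuted χ (valid hχ) V i
          (trans (bounded-eval (pointwise-bounded e) {V} {V} (λ _ _ → refl) χ i) f)
        where open C x ys ap nr cov dec
      by-case x ys ap nr cov dec G e (inj₂ G∈) j =
        j (satisfied φ (pointwise-Log {F = G} {F} (λ a b → sym (e a b)) φ (⋃ᶠ-member φ (good ds) G∈ h)))
        where open C x ys ap nr cov dec

-- Logics of finite frames, and deciding `β` in them

frame-normal : ∀ {w} (F : Rel w) → NormalTenseLogic (LogFrame F)
frame-normal F = record
  { A1ᴸ = λ φ ψ V u → let open Semantics (finModel F V) in ⇒I {u} {φ} {ψ ⇒ φ} λ a → ⇒I {u} {ψ} {φ} λ _ → a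
  ; A2ᴸ = λ φ ψ χ V u → let open Semantics (finModel F V) in
      ⇒I {u} {φ ⇒ ψ ⇒ χ} {(φ ⇒ ψ) ⇒ φ ⇒ χ} λ f → ⇒I {u} {φ ⇒ ψ} {φ ⇒ χ} λ g → ⇒I {u} {φ} {χ} λ a →
        ⇒E {u} {ψ} {χ} (⇒E {u} {φ} {ψ ⇒ χ} f a) (⇒E {u} {φ} {ψ} g a)
  ; A3ᴸ = λ φ V u → let open Semantics (finModel F V) in
      ⇒I {u} {¬' (¬' φ)} {φ} λ h → stable {u} {φ} λ k → ¬E {u} {¬' φ} h (¬I {u} {φ} k)
  ; K□ᴸ = λ φ ψ V u → let open Semantics (finModel F V) in
      ⇒I {u} {□ (φ ⇒ ψ)} {□ φ ⇒ □ ψ} λ f → ⇒I {u} {□ φ} {□ ψ} λ g → □I {u} {ψ} λ y r →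
        ⇒E {y} {φ} {ψ} (□E {u} {y} {φ ⇒ ψ} f r) (□E {u} {y} {φ} g r)
  ; K■ᴸ = λ φ ψ V u → let open Semantics (finModel F V) in
      ⇒I {u} {■ (φ ⇒ ψ)} {■ φ ⇒ ■ ψ} λ f → ⇒I {u} {■ φ} {■ ψ} λ g → ■I {u} {ψ} λ y r →
        ⇒E {y} {φ} {ψ} (■E {u} {y} {φ ⇒ ψ} f r) (■E {u} {y} {φ} g r)
  ; conv□ᴸ = λ φ V u → let open Semantics (finModel F V) in
      ⇒I {u} {φ} {□ (P φ)} λ a → □I {u} {P φ} λ y r → PI {y} {u} {φ} r a
  ; conv■ᴸ = λ φ V u → let open Semantics (finModel F V) in
      ⇒I {u} {φ} {■ (◇ φ)} λ a → ■I {u} {◇ φ} λ y r → ◇I {y} {u} {φ} r a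
  ; mpᴸ = λ {φ} {ψ} f a V u → let open Semantics (finModel F V) in ⇒E {u} {φ} {ψ} (f V u) (a V u)
  ; nec□ᴸ = λ {φ} a V u → let open Semantics (finModel F V) in □I {u} {φ} λ y _ → a V y
  ; nec■ᴸ = λ {φ} a V u → let open Semantics (finModel F V) in ■I {u} {φ} λ y _ → a V y
  ; subᴸ = λ {φ} σ a V u → Bisimulation.holds (substituted V σ) φ refl (a (λ v → eval F V (σ v)) u) }
  where
  substituted : ∀ V σ → Bisimulation (finModel F V) F _≡_ (λ v → eval F V (σ v)) σ
  substituted V σ = record
    { forth = λ { refl r k → k (_ , r , refl) } ; forth⁻ = λ { refl r k → k (_ , r , refl) }
    ; back = λ { refl r k → k (_ , r , refl) } ; back⁻ = λ { refl r k → k (_ , r , refl) }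
    ; pos = λ { v refl h → h } ; neg = λ { v refl h h' → true≢false h' h } }

frame-α : ∀ {w} (F : Rel w) l {K} → w ≤ K → LogFrame F (α l K)
frame-α {w} F l {K} le V u = subst (λ φ → eval F V φ u ≡ true) ([var] (α l K))
  (small-α {l} {K} {u} (cover-small (Near l u) _≈_ (λ {x} {y} {z} → ≈-euclid {x} {y} {z})
    (λ k → k (allFin w , subst (_≤ K) (sym (Lₚ.length-tabulate (id {A = Fin w}))) le ,
      λ x _ j → j (lose (∈ₚ.∈-allFin x) (≈-refl {x}))))) var)
  where open Semantics (finModel F V)

-- β is valid in a frame exactly when no point sees another one.
β : Fm
β = p 0 ⇒ □ (p 0)

does-sound : ∀ {P : Set} (d : Dec P) → does d ≡ true → P
does-sound (yes h) _ = h

β-dec : ∀ {w} (F : Rel w) → Dec (LogFrame F β)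
β-dec F with Fₚ.all? (λ i → Fₚ.all? (λ j → (F i j 𝔹.≟ false) ⊎-dec (i Fₚ.≟ j)))
... | yes h = yes λ V u → imp-intro λ a → allB-intro _ (allFin _) λ y → imp-intro λ r → step V u y a r (h u y)
  where
  step : ∀ V u y → V 0 u ≡ true → F u y ≡ true → F u y ≡ false ⊎ u ≡ y → V 0 y ≡ true
  step V u y a r (inj₁ f) = ⊥-elim (true≢false r f)
  step V u y a r (inj₂ refl) = a
-- Validity is tested with the valuation that is true exactly at `i`.
... | no n = no λ v → n λ i → λ j → step i j (bool-cases (F i j))
    (λ r → does-sound (i Fₚ.≟ j) (imp-elim (allB-elim _ (allFin _)
      (imp-elim (v (λ _ a → does (i Fₚ.≟ a)) i) (dec-true (i Fₚ.≟ i) refl)) (∈ₚ.∈-allFin j)) r))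
  where
  step : ∀ i j → F i j ≡ true ⊎ F i j ≡ false → (F i j ≡ true → i ≡ j) → F i j ≡ false ⊎ i ≡ j
  step i j (inj₁ t) f = inj₂ (f t)
  step i j (inj₂ t) f = inj₁ t

point : Rel 1
point _ _ = true

β-point : LogFrame point β
β-point V F.zero = imp-intro {V 0 F.zero} λ a →
  allB-intro (λ v → not (point F.zero v) ∨ V 0 v) (allFin 1) λ { F.zero → a }

-- Whether a derivation uses one of the axioms coming with a proof of Q can be read off.
kt-elim : ∀ {Γ M : Fm → Set} {Q : Set} → NormalTenseLogic M →
  (∀ {φ} → Γ φ → Q ⊎ M φ) → ∀ {φ} → Kt⊕ Γ φ → Q ⊎ M φ
kt-elim {Γ} {M} {Q} N f = go
  where
  open NormalTenseLogic N
  go : ∀ {φ} → Kt⊕ Γ φ → Q ⊎ M φ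
  go (ax h) = f h
  go (A1 φ ψ) = inj₂ (A1ᴸ φ ψ)
  go (A2 φ ψ χ) = inj₂ (A2ᴸ φ ψ χ)
  go (A3 φ) = inj₂ (A3ᴸ φ)
  go (K□ φ ψ) = inj₂ (K□ᴸ φ ψ)
  go (K■ φ ψ) = inj₂ (K■ᴸ φ ψ)
  go (conv□ φ) = inj₂ (conv□ᴸ φ)
  go (conv■ φ) = inj₂ (conv■ᴸ φ)
  go (mp d e) with go d | go e
  ... | inj₁ q | _ = inj₁ q
  ... | inj₂ _ | inj₁ q = inj₁ q
  ... | inj₂ a | inj₂ b = inj₂ (mpᴸ a b)
  go (nec□ d) with go d
  ... | inj₁ q = inj₁ q
  ... | inj₂ a = inj₂ (nec□ᴸ a)
  go (nec■ d) with go d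
  ... | inj₁ q = inj₁ q
  ... | inj₂ a = inj₂ (nec■ᴸ a)
  go (sub σ d) with go d
  ... | inj₁ q = inj₁ q
  ... | inj₂ a = inj₂ (subᴸ σ a)

kt-normal : ∀ Γ → NormalTenseLogic (Kt⊕ Γ)
kt-normal Γ = record
  { A1ᴸ = A1 ; A2ᴸ = A2 ; A3ᴸ = A3 ; K□ᴸ = K□ ; K■ᴸ = K■ ; conv□ᴸ = conv□ ; conv■ᴸ = conv■
  ; mpᴸ = mp ; nec□ᴸ = nec□ ; nec■ᴸ = nec■ ; subᴸ = sub }

[∘] : ∀ φ σ ρ → φ [ σ ] [ ρ ] ≡ φ [ (λ x → σ x [ ρ ]) ]
[∘] (var x) σ ρ = refl
[∘] ⊥' σ ρ = refl
[∘] (φ ⇒ ψ) σ ρ = cong₂ _⇒_ ([∘] φ σ ρ) ([∘] ψ σ ρ)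
[∘] (□ φ) σ ρ = cong □ ([∘] φ σ ρ)
[∘] (■ φ) σ ρ = cong ■ ([∘] φ σ ρ)

-- The logic of the canonical model of L in v variables.
Restricted : Logic → ℕ → Logic
Restricted L v φ = ∀ σ → L (φ [ σ ] [ τ v ])

restricted-normal : ∀ {L} → NormalTenseLogic L → ∀ v → NormalTenseLogic (Restricted L v)
restricted-normal {L} N v = record
  { A1ᴸ = λ _ _ _ → A1ᴸ _ _ ; A2ᴸ = λ _ _ _ _ → A2ᴸ _ _ _ ; A3ᴸ = λ _ _ → A3ᴸ _
  ; K□ᴸ = λ _ _ _ → K□ᴸ _ _ ; K■ᴸ = λ _ _ _ → K■ᴸ _ _
  ; conv□ᴸ = λ _ _ → conv□ᴸ _ ; conv■ᴸ = λ _ _ → conv■ᴸ _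
  ; mpᴸ = λ f a σ → mpᴸ (f σ) (a σ) ; nec□ᴸ = λ a σ → nec□ᴸ (a σ) ; nec■ᴸ = λ a σ → nec■ᴸ (a σ)
  ; subᴸ = λ {φ} ρ a σ → subst (λ ψ → L (ψ [ τ v ])) (sym ([∘] φ ρ σ)) (a (λ x → ρ x [ σ ])) }
  where open NormalTenseLogic N

-- Excluded middle from pretabularity

module Dichotomy (k l n m : ℕ) {L : Logic} (N : NormalTenseLogic L)
  (ext : S4BP (suc k) l n m ⊆ L) where
  open NormalTenseLogic N
  open Extension k l n m N ext

  -- A valuation on one point is given by constants. By reflexivity the total relation is a
  -- bisimulation from the canonical model to the point, so a theorem failing there would make `L`
  -- inconsistent.
  in-point : Consistent L → L ⊆ LogFrame point
  in-point con φ h V i with bool-cases (eval point V φ i)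
  ... | inj₁ t = t
  ... | inj₂ f = ⊥-elim (con (complete {⊥'} id λ x → exf {x} (Bisimulation.fails bis φ {x} tt f (valid h σ x))))
    where
    open At var (L ⊥')
    const : Bool → Fm
    const true = ⊤'
    const false = ⊥'
    σ : Subst
    σ v = const (V v F.zero)
    pos : ∀ {x} b → b ≡ true → x ⊩ const b
    pos {x} true h = ⊩⊤ {x}
    neg : ∀ {x} b → b ≡ false → x ⊩ const b → L ⊥'
    neg {x} false h g = ⊩⊥ {x} g
    bis : Bisimulation canonical point (λ _ _ → ⊤) V σ
    bis = record
      { forth = λ _ _ k → k (F.zero , refl , tt) ; forth⁻ = λ _ _ k → k (F.zero , refl , tt)
      ; back = λ {x} _ _ k → k (x , B.R-refl {x} , tt)
      ; back⁻ = λ {x} _ _ k → k (x , B.R-refl {x} , tt)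
      ; pos = λ { v {x} {F.zero} _ t → pos {x} (V v F.zero) t }
      ; neg = λ { v {x} {F.zero} _ t g → neg {x} (V v F.zero) t g } }

  few-variables : ∀ v A i y → v ≤ i → At._⊩_ (τ v) A y (var i) → A
  few-variables v A i y le h = ⊩⊥ {y} (⇒E {y} {var i} {⊥'}
    (sound {var i ⇒ ⊥'} (subst (λ φ → L (φ ⇒ ⊥')) (sym (τ-high {v} le))
      (Canonical.⇒-refl (theory-[] N var) A ⊥')) y) h)
    where open At (τ v) A

  bound : ℕ → ℕ
  bound v = (suc k * n + suc k * m) ^ l * 2 ^ v

  restricted-α : ∀ v {K} → bound v ≤ K → Restricted L v (α l K)
  restricted-α v {K} le σ = complete {α l K [ σ ]} id λ x → small-α {l} {K} {x}
    (cover-small (Near l x) _≈_ (λ {x} {y} {z} → ≈-euclid {x} {y} {z})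
      (cover-≤ le (B.component-points v (few-variables v _) x))) σ
    where open At (τ v) (L (α l K [ σ ] [ τ v ]))

  L-restricted : ∀ v → L ⊆ Restricted L v
  L-restricted v φ h σ = subᴸ (τ v) (subᴸ σ h)

  -- The instances of `β` make related points equivalent, so a whole component is a single class.
  β-α : L β → L (α l 1)
  β-α h = subst L ([var] (α l 1)) (complete {α l 1} id λ x →
      subst (x ⊩_) ([var] (α l 1)) (small-α {l} {1} {x} (small x) var))
    where
    open At var (L (α l 1 [ var ]))
    R⇒≈ : ∀ {x y} → R x y → y ≈ x
    R⇒≈ {x} {y} r φ hx = □E {x} {y} {φ} (⇒E {x} {φ} {□ φ} (valid h (λ _ → φ) x) hx) r
    near⇒≈ : ∀ {j x y} → Near j x y → y ≈ x
    near⇒≈ {x = x} nil = ≈-refl {x}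
    near⇒≈ (cons (inj₁ refl) nr) = near⇒≈ nr
    near⇒≈ {x = x} (cons {y = u} (inj₂ (inj₁ r)) nr) φ hx = near⇒≈ nr φ (R⇒≈ {x} {u} r φ hx)
    near⇒≈ {x = x} (cons {y = u} (inj₂ (inj₂ r)) nr) φ hx =
      near⇒≈ nr φ (≈-sym {x} {u} (R⇒≈ {u} {x} r) φ hx)
    small : ∀ x → Small {L (α l 1 [ var ])} (Near l x) _≈_ 1
    small x (y ∷ z ∷ []) refl ((a ∷ []) ∷ _) (ny ∷ nz ∷ []) =
      a (≈-euclid {y} {z} {x} (near⇒≈ ny) (near⇒≈ nz))

  module _ (ntab : ¬ Tabular L)
    (pre : ∀ L' → Ext L L' → Consistent L' → (Σ Fm λ φ → L' φ × ¬ L φ) → Tabular L') where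

    ¬α : ∀ K → ¬ L (α l K)
    ¬α K h = bounded-tabular K h ntab

    -- The inconsistent logic is tabular, being the logic of the empty frame.
    consistent : Consistent L
    consistent h = ntab (0 , (λ ()) , (λ φ _ V ()) , λ φ _ → mpᴸ (mpᴸ ⊥⇒ ⊥⇒⊤) h)
      where
      ⊥⇒ : ∀ {φ} → L ((⊥' ⇒ ¬' (¬' φ)) ⇒ ⊥' ⇒ φ)
      ⊥⇒ = mpᴸ (A2ᴸ _ _ _) (mpᴸ (A1ᴸ _ _) (A3ᴸ _))
      ⊥⇒⊤ : ∀ {φ} → L (⊥' ⇒ ¬' (¬' φ))
      ⊥⇒⊤ = A1ᴸ _ _

    -- The logic L + α_K + {β | Q} properly extends L, so it is tabular and hence
    -- decides β; this decides Q since β is not provable in L + α_K.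
    data Γ (Q : Set) (K : ℕ) : Fm → Set where
      isL : ∀ {φ} → L φ → Γ Q K φ
      isα : Γ Q K (α l K)
      isβ : Q → Γ Q K β

    em : ∀ (Q : Set) → Q ⊎ ¬ Q
    em Q = decide (pre L' (kt-normal _ , λ φ h → ax (isL h)) con (α l K , ax isα , ¬α K))
      where
      -- At least `bound 1`, since `β` has one variable, and at least 1, the size of `point`.
      K : ℕ
      K = suc (bound 1)
      L' : Logic
      L' = Kt⊕ (Γ Q K)
      con : Consistent L'
      con d with kt-elim {Q = ⊥} (frame-normal point) inPoint d
        where
        inPoint : ∀ {φ} → Γ Q K φ → ⊥ ⊎ LogFrame point φ
        inPoint (isL h) = inj₂ (in-point consistent _ h)
        inPoint isα = inj₂ (frame-α point l {K} (s≤s z≤n))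
        inPoint (isβ _) = inj₂ β-point
      ... | inj₂ v = true≢false (v (λ _ _ → true) F.zero) refl
      restricted : ∀ {φ} → Γ Q K φ → Q ⊎ Restricted L 1 φ
      restricted (isL h) = inj₂ (L-restricted 1 _ h)
      restricted isα = inj₂ (restricted-α 1 (ℕₚ.n≤1+n _))
      restricted (isβ q) = inj₁ q
      decide : Tabular L' → Q ⊎ ¬ Q
      decide (w , F , inc , cni) with β-dec F
      ... | no nβ = inj₂ λ q → nβ (inc β (ax (isβ q)))
      ... | yes hβ with kt-elim (restricted-normal N 1) restricted (cni β hβ)
      ...   | inj₁ q = inj₁ q
      -- Now `β` is provable in `L` itself, which bounds its components by one point.
      ...   | inj₂ h = ⊥-elim (¬α 1 (β-α (h var)))

-- Blowing up a cluster

Shape : Set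
Shape = Σ ℕ λ w → Rel w × Fin w

module _ {w} (x : Fin w) (c : ℕ) where
  fold : Fin w ⊎ Fin c → Fin w
  fold (inj₁ i) = i
  fold (inj₂ _) = x

  collapse : Fin (w + c) → Fin w
  collapse a = fold (splitAt w a)

  collapse-↑ˡ : ∀ i → collapse (i ↑ˡ c) ≡ i
  collapse-↑ˡ i = cong fold (Fₚ.splitAt-↑ˡ w i c)

  collapse-↑ʳ : ∀ j → collapse (w ↑ʳ j) ≡ x
  collapse-↑ʳ j = cong fold (Fₚ.splitAt-↑ʳ w c j)

blow : ∀ {w} → Rel w → (x : Fin w) → (c : ℕ) → Rel (w + c)
blow r x c a b = r (collapse x c a) (collapse x c b)

BlowLog : Shape → ℕ → Logic
BlowLog (w , r , x) c = LogFrame (blow r x c)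

Unbounded : Shape → Logic
Unbounded s χ = ∀ c → BlowLog s c χ

shapes : ℕ → List Shape
shapes N = concatMap (λ w → concatMap (λ r → map (λ x → (w , r , x)) (allFin w)) (relations w))
  (upTo (suc N))

shapes-complete : ∀ {N w} → w ≤ N → (r : Rel w) (x : Fin w) → Σ Shape λ s → s ∈ shapes N ×
  (∀ c → LogFrame (blow r x c) ⊆ BlowLog s c)
shapes-complete le r x with relations-complete r
... | r' , r'∈ , e = (_ , r' , x) ,
  ∈ₚ.∈-concatMap⁺ (λ w → concatMap (λ r → map {B = Shape} (λ x → (w , r , x)) (allFin w)) (relations w))
    (lose (∈ₚ.∈-upTo⁺ (s≤s le))
      (∈ₚ.∈-concatMap⁺ (λ r → map {B = Shape} (λ x → (_ , r , x)) (allFin _))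
        (lose r'∈ (∈ₚ.∈-map⁺ (λ x → (_ , r' , x)) (∈ₚ.∈-allFin x))))) ,
  λ c → pointwise-Log {F = blow r x c} {blow r' x c} λ i j → e (collapse x c i) (collapse x c j)

strong-onto : ∀ {w w'} {F : Rel w} {G : Rel w'} (f : Fin w → Fin w') →
  (∀ a b → F a b ≡ G (f a) (f b)) → (∀ b → Σ (Fin w) λ a → f a ≡ b) → LogFrame F ⊆ LogFrame G
strong-onto {F = F} {G} f e onto = bounded-onto {F = F} {G} {f} (record
  { forth = λ h → trans (sym (e _ _)) h
  ; back = λ {a} {c} h → let b , eq = onto c in b , trans (e a b) (subst (λ c → G (f a) c ≡ true) (sym eq) h) , eq
  ; back⁻ = λ {a} {c} h → let b , eq = onto c in b , trans (e b a) (subst (λ c → G c (f a) ≡ true) (sym eq) h) , eq })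
  onto

-- `F` is the pullback of `r` along `g`, so a map into the blow-up that lies over `g` preserves and
-- reflects the relation. For surjectivity the points `zs` of the fibre go to the added copies, and
-- `z` is left to hit `x` itself.
module ToBlow {w w'} (F : Rel w) (r : Rel w') (x : Fin w') (g : Fin w → Fin w')
  (F-r : ∀ a b → F a b ≡ r (g a) (g b)) (z : Fin w) (zs : List (Fin w))
  (distinct : AllPairs (λ a b → ¬ a ≡ b) (z ∷ zs)) (fibre : All (λ a → g a ≡ x) (z ∷ zs))
  (onto : ∀ j → Σ (Fin w) λ a → g a ≡ j) where

  c : ℕ
  c = length zs

  f : Fin w → Fin (w' + c)
  f a with Any.any? (a Fₚ.≟_) zs
  ... | yes i = w' ↑ʳ Any.index i
  ... | no _ = g a ↑ˡ c

  in-fibre : ∀ {a} → Any (a ≡_) zs → g a ≡ x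
  in-fibre i with find i
  ... | b , b∈ , refl = All.lookup fibre (there b∈)

  collapse-f : ∀ a → collapse x c (f a) ≡ g a
  collapse-f a with Any.any? (a Fₚ.≟_) zs
  ... | yes i = trans (collapse-↑ʳ x c (Any.index i)) (sym (in-fibre i))
  ... | no _ = collapse-↑ˡ x c (g a)

  f-out : ∀ {a} → ¬ Any (a ≡_) zs → f a ≡ g a ↑ˡ c
  f-out {a} n with Any.any? (a Fₚ.≟_) zs
  ... | yes i = ⊥-elim (n i)
  ... | no _ = refl

  lookup-injective : ∀ {X : Set} {xs : List X} → AllPairs (λ a b → ¬ a ≡ b) xs →
    ∀ i j → lookup xs i ≡ lookup xs j → i ≡ j
  lookup-injective ap i j e with Fₚ.<-cmp i j
  ... | tri< lt _ _ = ⊥-elim (AllPairs-lookup ap lt e)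
  ... | tri≈ _ eq _ = eq
  ... | tri> _ _ gt = ⊥-elim (AllPairs-lookup ap gt (sym e))

  f-in : ∀ j → f (lookup zs j) ≡ w' ↑ʳ j
  f-in j with Any.any? (lookup zs j Fₚ.≟_) zs
  ... | yes i = cong (w' ↑ʳ_) (lookup-injective (tl distinct) _ _ (sym (Anyₚ.lookup-index i)))
    where
    tl : ∀ {X : Set} {Q : X → X → Set} {x xs} → AllPairs Q (x ∷ xs) → AllPairs Q xs
    tl (_ ∷ qs) = qs
  ... | no n = ⊥-elim (n (lose (∈ₚ.∈-lookup j) refl))

  f-onto : ∀ b → Σ (Fin w) λ a → f a ≡ b
  f-onto b with splitAt w' b in eq
  ... | inj₂ j = lookup zs j , trans (f-in j) (Fₚ.splitAt⁻¹-↑ʳ eq)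
  ... | inj₁ j with j Fₚ.≟ x | onto j
  ...   | yes refl | _ = z , trans (f-out λ i → notin distinct i)
            (trans (cong (_↑ˡ c) (hd fibre)) (Fₚ.splitAt⁻¹-↑ˡ eq))
    where
    hd : ∀ {X : Set} {Q : X → Set} {x xs} → All Q (x ∷ xs) → Q x
    hd (q ∷ _) = q
    notin : AllPairs (λ a b → ¬ a ≡ b) (z ∷ zs) → ¬ Any (z ≡_) zs
    notin (n ∷ _) i = All.lookup n (proj₁ (proj₂ (find i))) (proj₂ (proj₂ (find i)))
  ...   | no ne | a , refl = a , trans (f-out λ i → ne (in-fibre i)) (Fₚ.splitAt⁻¹-↑ˡ eq)

  Log-⊆ : LogFrame F ⊆ LogFrame (blow r x c)
  Log-⊆ = strong-onto f (λ a b → trans (F-r a b)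
    (sym (cong₂ r (collapse-f a) (collapse-f b)))) f-onto

-- Surplus copies are folded back onto `x`.
blow-mono : ∀ s {c c'} → c ≤ c' → BlowLog s c' ⊆ BlowLog s c
blow-mono (w , r , x) {c} {c'} le = strong-onto f
  (λ a b → sym (cong₂ r (collapse-f a) (collapse-f b))) onto
  where
  g : Fin w ⊎ Fin c' → Fin (w + c)
  g (inj₁ i) = i ↑ˡ c
  g (inj₂ j) with toℕ j ℕ.<? c
  ... | yes lt = w ↑ʳ fromℕ< lt
  ... | no _ = x ↑ˡ c
  f : Fin (w + c') → Fin (w + c)
  f a = g (splitAt w a)
  collapse-g : ∀ s → collapse x c (g s) ≡ fold x c' s
  collapse-g (inj₁ i) = collapse-↑ˡ x c i
  collapse-g (inj₂ j) with toℕ j ℕ.<? c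
  ... | yes lt = collapse-↑ʳ x c (fromℕ< lt)
  ... | no _ = collapse-↑ˡ x c x
  collapse-f : ∀ a → collapse x c (f a) ≡ collapse x c' a
  collapse-f a = collapse-g (splitAt w a)
  g-inject : ∀ j → g (inj₂ (F.inject≤ j le)) ≡ w ↑ʳ j
  g-inject j with toℕ (F.inject≤ j le) ℕ.<? c
  ... | yes lt = cong (w ↑ʳ_) (Fₚ.toℕ-injective (trans (Fₚ.toℕ-fromℕ< lt) (Fₚ.toℕ-inject≤ j le)))
  ... | no n = ⊥-elim (n (subst (_< c) (sym (Fₚ.toℕ-inject≤ j le)) (Fₚ.toℕ<n j)))
  onto : ∀ b → Σ (Fin (w + c')) λ a → f a ≡ b
  onto b with splitAt w b in eq
  ... | inj₁ i = i ↑ˡ c' , trans (cong g (Fₚ.splitAt-↑ˡ w i c')) (Fₚ.splitAt⁻¹-↑ˡ eq)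
  ... | inj₂ j = w ↑ʳ F.inject≤ j le ,
    trans (cong g (Fₚ.splitAt-↑ʳ w c' _)) (trans (g-inject j) (Fₚ.splitAt⁻¹-↑ʳ eq))

module LargeCluster {w} (F : Rel w) (F-refl : ∀ a → F a a ≡ true)
  (F-trans : ∀ {a b c} → F a b ≡ true → F b c ≡ true → F a c ≡ true) where

  Same : Fin w → Fin w → Set
  Same a b = F a b ≡ true × F b a ≡ true

  bool-≡ : ∀ {a b} → (a ≡ true → b ≡ true) → (b ≡ true → a ≡ true) → a ≡ b
  bool-≡ {true} f g = sym (f refl)
  bool-≡ {false} {false} f g = refl
  bool-≡ {false} {true} f g = g refl

  -- The representatives of the clusters form the shape, and `F` is a pullback of their frame. If
  -- every cluster had at most `c` points, `N * c` points would cover `F`; so some fibre has `c + 1`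
  -- points and `ToBlow` applies.
  large : ∀ {N c} → Small {⊥} (λ _ → ⊤) Same N → N * c < w →
    DN ⊥ (Σ Shape λ s → proj₁ s ≤ N × LogFrame F ⊆ BlowLog s c)
  large {N} {c} small lt k = greedy (λ _ → ⊤) Same small λ (cs , le , ap , _ , cov) →
    dn-Fin w (λ i → cov i tt) (clustered cs le ap)
    where
    clustered : ∀ cs → length cs ≤ N → AllPairs (λ a b → ¬ Same a b) cs →
      (∀ i → Any (Same i) cs) → ⊥
    clustered cs le ap near = dn-em {X = Σ (Fin (length cs)) λ x → ¬ Small {⊥} (λ i → g i ≡ x) _≡_ c} λ
      { (inj₁ (x , ns)) → ns λ
          { (z ∷ zs) eq dist fib → k ((length cs , r , x) , le ,
              subst (λ c → LogFrame F ⊆ LogFrame (blow r x c)) (ℕₚ.suc-injective eq)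
                (ToBlow.Log-⊆ F r x g F-r z zs dist fib λ j → lookup cs j , g-rep j)) }
      ; (inj₂ none) → cover-small (λ _ → ⊤) _≡_ (λ { refl refl → refl })
          (cover-bind {Q = λ _ → ⊤} {E = _≡_} {Q' = λ _ → ⊤} {E' = λ a b → g a ≡ g b} {M = N} {N = c}
            (λ j → j (cs , le , λ a _ j → j (lose (∈ₚ.∈-lookup (g a)) (sym (g-rep (g a))))))
            (λ y j → none (g y , λ sm → greedy (λ i → g i ≡ g y) _≡_ sm λ (ys , l , _ , _ , h) →
              j (ys , l , λ a (_ , e) → h a e)))
            (λ _ _ → tt))
          (tabulate pts) (Lₚ.length-tabulate pts)
          (AllPairsₚ.tabulate⁺-< λ {i} {j} i<j e →
            ℕₚ.<⇒≢ i<j (cong toℕ (Fₚ.inject≤-injective lt lt i j e)))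
          (Allₚ.tabulate⁺ {f = pts} λ _ → tt) }
      where
      pts : Fin (suc (N * c)) → Fin w
      pts i = F.inject≤ i lt
      g : Fin w → Fin (length cs)
      g i = Any.index (near i)
      g-same : ∀ i → Same i (lookup cs (g i))
      g-same i = Anyₚ.lookup-index (near i)
      r : Rel (length cs)
      r a b = F (lookup cs a) (lookup cs b)
      F-r : ∀ a b → F a b ≡ r (g a) (g b)
      F-r a b = bool-≡
        (λ h → F-trans (proj₂ (g-same a)) (F-trans h (proj₁ (g-same b))))
        (λ h → F-trans (proj₁ (g-same a)) (F-trans h (proj₂ (g-same b))))
      g-rep : ∀ j → g (lookup cs j) ≡ j
      g-rep j with Fₚ.<-cmp (g (lookup cs j)) j
      ... | tri< l _ _ = ⊥-elim (AllPairs-lookup ap l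
              (proj₂ (g-same (lookup cs j)) , proj₁ (g-same (lookup cs j))))
      ... | tri≈ _ eq _ = eq
      ... | tri> _ _ l = ⊥-elim (AllPairs-lookup ap l (g-same (lookup cs j)))

-- If `a` did not see itself, the valuation false exactly at `a` would refute the axiom.
T-reflexive : ∀ {w} (F : Rel w) → LogFrame F (□ (p 0) ⇒ p 0) → ∀ a → F a a ≡ true
T-reflexive F valid a = bool-stable λ n → true≢false
  (imp-elim (valid (λ _ b → not (does (a Fₚ.≟ b))) a)
    (allB-intro _ (allFin _) λ b → imp-intro {F a b} λ h → off b h (a Fₚ.≟ b) n))
  (cong not (dec-true (a Fₚ.≟ a) refl))
  where
  off : ∀ b → F a b ≡ true → (d : Dec (a ≡ b)) → ¬ F a a ≡ true → not (does d) ≡ true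
  off b h (yes refl) n = ⊥-elim (n h)
  off b h (no _) n = refl

-- The point `x` and its `c` copies are told apart by letting variable `v` be true at the point
-- numbered `v`. All are seen from `x` in one step, for which `suc l` leaves room.
blow-refutes-α : ∀ {w} (r : Rel w) x → r x x ≡ true → ∀ l c → ¬ LogFrame (blow r x c) (α (suc l) c)
blow-refutes-α {w} r x rxx l c valid = α-small {suc l} {c} {base}
    (λ σ → NormalTenseLogic.subᴸ (frame-normal (blow r x c)) {α (suc l) c} σ valid V base)
    (tabulate pts) (Lₚ.length-tabulate pts)
    (AllPairsₚ.tabulate⁺-< {f = pts} λ {i} {j} i<j e → ℕₚ.<⇒≢ i<j (cong toℕ (pts-inj i j
      (V-sound (pts i) (pts j) (e (p (toℕ (pts j))) (V-refl (pts j)))))))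
    (Allₚ.tabulate⁺ {f = pts} λ i → cons (inj₂ (inj₁
      (trans (cong₂ r (collapse-↑ˡ x c x) (pts-collapse i)) rxx))) (near-refl l))
  where
  base : Fin (w + c)
  base = x ↑ˡ c
  V : ℕ → Fin (w + c) → Bool
  V v a = does (toℕ a ≟ v)
  open Semantics (finModel (blow r x c) V)
  pts : Fin (suc c) → Fin (w + c)
  pts F.zero = base
  pts (F.suc j) = w ↑ʳ j
  pts-collapse : ∀ i → collapse x c (pts i) ≡ x
  pts-collapse F.zero = collapse-↑ˡ x c x
  pts-collapse (F.suc j) = collapse-↑ʳ x c j
  V-refl : ∀ a → V (toℕ a) a ≡ true
  V-refl a = dec-true (toℕ a ≟ toℕ a) refl
  V-sound : ∀ a b → V (toℕ b) a ≡ true → a ≡ b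
  V-sound a b h = Fₚ.toℕ-injective (does-sound (toℕ a ≟ toℕ b) h)
  left≢right : ∀ (i : Fin w) (j : Fin c) → ¬ i ↑ˡ c ≡ w ↑ʳ j
  left≢right i j e with () ← trans (sym (Fₚ.splitAt-↑ˡ w i c)) (trans (cong (splitAt w) e) (Fₚ.splitAt-↑ʳ w c j))
  pts-inj : ∀ i j → pts i ≡ pts j → i ≡ j
  pts-inj F.zero F.zero e = refl
  pts-inj F.zero (F.suc j) e = ⊥-elim (left≢right x j e)
  pts-inj (F.suc i) F.zero e = ⊥-elim (left≢right x i (sym e))
  pts-inj (F.suc i) (F.suc j) e = cong F.suc (Fₚ.↑ʳ-injective w i j e)

unbounded-normal : ∀ s → NormalTenseLogic (Unbounded s)
unbounded-normal (w , r , x) = record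
  { A1ᴸ = λ φ ψ c → A1ᴸ (N c) φ ψ ; A2ᴸ = λ φ ψ χ c → A2ᴸ (N c) φ ψ χ ; A3ᴸ = λ φ c → A3ᴸ (N c) φ
  ; K□ᴸ = λ φ ψ c → K□ᴸ (N c) φ ψ ; K■ᴸ = λ φ ψ c → K■ᴸ (N c) φ ψ
  ; conv□ᴸ = λ φ c → conv□ᴸ (N c) φ ; conv■ᴸ = λ φ c → conv■ᴸ (N c) φ
  ; mpᴸ = λ {φ} {ψ} f a c → mpᴸ (N c) {φ} {ψ} (f c) (a c)
  ; nec□ᴸ = λ {φ} a c → nec□ᴸ (N c) {φ} (a c) ; nec■ᴸ = λ {φ} a c → nec■ᴸ (N c) {φ} (a c)
  ; subᴸ = λ {φ} σ a c → subᴸ (N c) {φ} σ (a c) }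
  where
  open NormalTenseLogic
  N : ∀ c → NormalTenseLogic (LogFrame (blow r x c))
  N c = frame-normal (blow r x c)

-- Otherwise every listed `s` fails at some number; by monotonicity all of them fail at the maximum
-- `C`, against the hypothesis at `C`.
uniform : (∀ (Q : Set) → Q ⊎ ¬ Q) → ∀ {X : Set} (G : X → ℕ → Set) →
  (∀ s {c c'} → c ≤ c' → G s c' → G s c) → ∀ xs → (∀ c → Σ X λ s → s ∈ xs × G s c) →
  Σ X λ s → s ∈ xs × (∀ c → G s c)
uniform em {X} G mono xs h with go xs
  where
  go : ∀ ys → (Σ X λ s → s ∈ ys × (∀ c → G s c)) ⊎ (Σ ℕ λ C → ∀ s → s ∈ ys → ¬ G s C)
  go [] = inj₂ (0 , λ _ ())
  go (y ∷ ys) with em (Σ ℕ λ c → ¬ G y c) | go ys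
  ... | _ | inj₁ (s , i , g) = inj₁ (s , there i , g)
  ... | inj₁ (c , n) | inj₂ (C , ns) = inj₂ (c ℕ.⊔ C , λ
    { s (here refl) g → n (mono s (ℕₚ.m≤m⊔n c C) g)
    ; s (there i) g → ns s i (mono s (ℕₚ.m≤n⊔m c C) g) })
  ... | inj₂ n | inj₂ _ = inj₁ (y , here refl , λ c → good c (em (G y c)))
    where
    good : ∀ c → G y c ⊎ ¬ G y c → G y c
    good c (inj₁ g) = g
    good c (inj₂ ng) = ⊥-elim (n (c , ng))
... | inj₁ r = r
... | inj₂ (C , ns) with h C
...   | s , i , g = ⊥-elim (ns s i g)

-- Pretabular logics as logics of blow-ups

module Classification (k l n m : ℕ) {L : Logic} (N : NormalTenseLogic L)
  (ext : S4BP (suc k) (suc l) n m ⊆ L) (ntab : ¬ Tabular L)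
  (pre : ∀ L' → Ext L L' → Consistent L' → (Σ Fm λ φ → L' φ × ¬ L φ) → Tabular L') where
  open Extension k (suc l) n m N ext
  open Dichotomy k (suc l) n m N ext hiding (¬α; em)

  ¬α : ∀ K → ¬ L (α (suc l) K)
  ¬α = Dichotomy.¬α k (suc l) n m N ext ntab pre

  em : ∀ (Q : Set) → Q ⊎ ¬ Q
  em = Dichotomy.em k (suc l) n m N ext ntab pre

  clusterBound : ℕ
  clusterBound = (suc k * n + suc k * m) ^ suc l

  Fits : ℕ → ℕ → Set
  Fits M c = Σ Shape λ s → proj₁ s ≤ M × L ⊆ BlowLog s c

  -- In finitely many variables a component has few clusters and finitely many
  -- points, but more than K points if it refutes α K.
  component-shape : ∀ c K v → vars< (α (suc l) K) ≤ v → clusterBound * c ≤ K →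
    DN ⊥ (Fits clusterBound c)
  component-shape c K v vle Kle found = complete {α (suc l) K}
      -- As `v` covers the variables of `α`, the substitution `τ v` fixes it, and it stays
      -- unprovable in the `v`-variable theory.
      (λ h → ¬α K (subst L ([τ] v (α (suc l) K) vle) h)) λ x → stable {x} {α (suc l) K} λ j →
      greedy (Near (suc l) x) _≈_ {bound v} (cover-small (Near (suc l) x) _≈_ (λ {x} {y} {z} → ≈-euclid {x} {y} {z})
        (B.component-points v (few-variables v ⊥) x)) λ (ys , _ , ap , nr , cov) →
      decide-R ys λ dec → component x j ys ap nr cov dec
    where
    open At (τ v) ⊥
    component : ∀ x → ¬ (x ⊩ α (suc l) K) → ∀ ys ap nr cov dec → ⊥
    component x j ys ap nr cov dec with length ys ℕ.≤? K
    ... | yes le = j (subst (x ⊩_) ([var] (α (suc l) K)) (small-α {suc l} {K} {x}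
          (cover-small (Near (suc l) x) _≈_ (λ {x} {y} {z} → ≈-euclid {x} {y} {z})
            (λ k → k (ys , le , cov))) var))
    ... | no nle = LargeCluster.large F (λ a → bool-stable (F-complete (B.R-refl {pt a})))
          (λ {a} {b} {c} h g → bool-stable (F-complete (B.R-trans {pt a} {pt b} {pt c} (F-sound h) (F-sound g))))
          small (ℕₚ.≤-<-trans Kle (ℕₚ.≰⇒> nle)) λ (s , le , inc) → found (s , le , λ χ h → inc χ
            (not-bad (w , F) (λ (χ , h , V , i , f) → refuted χ (valid h) V i f) χ h))
      where
      open C x ys ap nr cov dec
      small : Small {⊥} (λ _ → ⊤) (λ a b → F a b ≡ true × F b a ≡ true) clusterBound
      small is eq ap' _ = cover-small (Near (suc l) x) B._~_
        (λ {x} {y} {z} e f → B.~-trans {x} {z} {y} e (B.~-sym {y} {z} f))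
        (B.component-clusters x) (map pt is) (trans (Lₚ.length-map pt is) eq)
        (AllPairsₚ.map⁺ (AllPairs.map (λ ne (r , s) → F-complete r λ h → F-complete s λ g → ne (h , g)) ap'))
        (Allₚ.map⁺ (All.tabulate λ {i} _ → pt-near i))

  shape-exists : ∀ c K → clusterBound * c ≤ K →
    DN ⊥ (Fits clusterBound c)
  shape-exists c K = component-shape c K (vars< (α (suc l) K)) (ℕₚ.≤-refl {vars< (α (suc l) K)})

  fits-listed : ∀ M c → Fits M c → Σ Shape λ s → s ∈ shapes M × L ⊆ BlowLog s c
  fits-listed M c ((w , r , x) , le , inc) =
    let s , s∈ , inc' = shapes-complete le r x in s , s∈ , λ χ h → inc' c χ (inc χ h)

  blow-up : ∀ c → Fits clusterBound c
  blow-up c = dne (em (Fits clusterBound c))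
    (shape-exists c (clusterBound * c) (ℕₚ.≤-refl {clusterBound * c}))
    where
    dne : ∀ {Q : Set} → Q ⊎ ¬ Q → ¬ ¬ Q → Q
    dne (inj₁ q) _ = q
    dne (inj₂ n) nn = ⊥-elim (nn n)

  reflexive : ∀ {w} (r : Rel w) x → L ⊆ LogFrame (blow r x 0) → r x x ≡ true
  reflexive r x h = trans (sym (cong₂ r (collapse-↑ˡ x 0 x) (collapse-↑ˡ x 0 x)))
    (T-reflexive (blow r x 0) (h _ (ext _ (ax T))) (x ↑ˡ 0))

  -- If `Unbounded s` were a proper extension of `L`, it would be the logic of a frame with some
  -- number `q` of points and so contain the `α` for `q`, which the blow-up by `q` copies refutes.
  ≐-Unbounded : ∀ s → (∀ c → L ⊆ BlowLog s c) → L ≐ Unbounded s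
  ≐-Unbounded s@(w , r , x) h = (λ φ t c → h c φ t) , λ φ t → back φ t (em (L φ))
    where
    back : ∀ φ → Unbounded s φ → L φ ⊎ ¬ L φ → L φ
    back φ t (inj₁ y) = y
    back φ t (inj₂ no') with pre (Unbounded s) (unbounded-normal s , λ φ t c → h c φ t)
      (λ b → true≢false (b 0 (λ _ _ → true) (x ↑ˡ 0)) refl) (φ , t , no')
    ... | q , G , _ , cni =
      ⊥-elim (blow-refutes-α r x (reflexive r x (h 0)) l q (cni (α (suc l) q) (frame-α G (suc l) ℕₚ.≤-refl) q))

  classified : ∀ M → (∀ c → Fits M c) → Any (L ≐_) (map Unbounded (shapes M))
  classified M fits =
    let s , s∈ , h = uniform em (λ s c → L ⊆ BlowLog s c)
          (λ s le h φ t → blow-mono s le φ (h φ t)) (shapes M) (λ c → fits-listed M c (fits c))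
    in Anyₚ.map⁺ (lose s∈ (≐-Unbounded s h))

theorem5p18 : (k l n m : ℕ) → 1 ≤ k → 1 ≤ l → 1 ≤ n → 1 ≤ m →
    FinitelyManyPTAB (S4BP k l n m)
theorem5p18 (suc k) (suc l) n m _ _ _ _ =
  map Unbounded (shapes ((suc k * n + suc k * m) ^ suc l)) ,
  λ L ((N , ext) , ntab , pre) → let open Classification k l n m N ext ntab pre in
    classified clusterBound blow-up
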